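{- Let $\psi(q)=\sum_{n=1}^\infty \frac{q^{n^2}}{(q;q^2)_n}$, and for $n\ge1$ let $p^o_{do}(n)$ denote the number of partitions of $n$ into an odd number of distinct parts with the smallest part being odd. Then \[ (-q;q)_\infty\,\psi(-q)=-\sum_{n\ge 1}p^o_{do}(n)q^n. \]
   Context: Notation: $(a;q)_n=(1-a)(1-aq)\cdots(1-aq^{n-1})$ and $(a;q)_\infty=\prod_{n\ge 0}(1-aq^n)$, $|q|<1$. -}

module Defs where

open import Data.Bool using (Bool; true; false; _∧_; if_then_else_)
open import Data.Nat as ℕ using (ℕ; zero; suc; _∸_; _%_; _≡ᵇ_; _≤ᵇ_; _⊓_)
open import Data.Integer as ℤ using (ℤ; +_; -_; _+_; _*_)
open import Data.List using (List; []; _∷_; _++_; map; length; filterᵇ; applyUpTo; foldr)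
open import Data.Nat.ListAction using (sum)

Series : Set
Series = ℕ → ℤ

Σ≤ : ℕ → (ℕ → ℤ) → ℤ
Σ≤ zero    f = f zero
Σ≤ (suc n) f = Σ≤ n f + f (suc n)

one : Series
one zero    = + 1
one (suc _) = + 0

_⊛_ : Series → Series → Series
(f ⊛ g) n = Σ≤ n (λ i → f i * g (n ∸ i))

infixl 7 _⊛_

shift : ℕ → Series → Series
shift m f n = if m ≤ᵇ n then f (n ∸ m) else + 0

onePlusQ : ℕ → Series
onePlusQ m n = if n ≡ᵇ 0 then + 1 else (if n ≡ᵇ m then + 1 else + 0)

-- 1/(1 - q^m) for m ≥ 1 (geometric series Σ_j q^{m j}); used only with m odd
geomInv : ℕ → Series
geomInv m n = if n % suc (m ∸ 1) ≡ᵇ 0 then + 1 else + 0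

prodPlus : ℕ → Series
prodPlus zero    = one
prodPlus (suc k) = prodPlus k ⊛ onePlusQ (suc k)

-- (-q;q)_∞ : the coefficient of q^N equals that of the finite product up to k = N
minusQInf : Series
minusQInf N = prodPlus N N

invQQ2 : ℕ → Series
invQQ2 zero    = one
invQQ2 (suc k) = invQQ2 k ⊛ geomInv (2 ℕ.* k ℕ.+ 1)

-- ψ(q) = Σ_{n≥1} q^{n²}/(q;q²)_n ; terms with n > N do not contribute to q^N
ψ : Series
ψ N = Σ≤ N (λ n → if n ≡ᵇ 0 then + 0 else shift (n ℕ.* n) (invQQ2 n) N)

negQ : Series → Series
negQ f n = if n % 2 ≡ᵇ 0 then f n else - f n

-- Partitions into distinct parts, as sublists of [1, 2, …, n].

sublists : List ℕ → List (List ℕ)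
sublists []       = [] ∷ []
sublists (x ∷ xs) = sublists xs ++ map (x ∷_) (sublists xs)

oddᵇ : ℕ → Bool
oddᵇ n = n % 2 ≡ᵇ 1

minPart : List ℕ → ℕ
minPart []       = 0
minPart (x ∷ xs) = foldr _⊓_ x xs

pdo : ℕ → ℕ
pdo n = length (filterᵇ (λ s → (sum s ≡ᵇ n) ∧ oddᵇ (length s) ∧ oddᵇ (minPart s))
                        (sublists (applyUpTo suc n)))

rhs : Series
rhs zero    = + 0
rhs (suc n) = - (+ pdo (suc n))

{-# OPTIONS --safe #-}
-- Write D(y) and W(y) for the sums of y^alt(λ) q^|λ| over the partitions λ into distinct parts,
-- respectively over those with an odd number of parts and odd smallest part, where
-- alt(λ) = λ₁ − λ₂ + λ₃ − ⋯.  Conjugation turns both into sums over the number of parts,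
-- and comparing these term by term at y and yq² gives
--   (1 − yq) D(y) = D(yq²),    (1 − y²q²) W(y) + yq W(yq²) = yq D(yq²).
-- Put U_j = W(q^(2j)) / ((1 − q)(1 − q³)⋯(1 − q^(2j−1))).  Since D(1) = (−q;q)_∞, this becomes
--   (1 + q^(2j+1)) U_j + q^(2j+1) U_(j+1) = q^(2j+1) (−q;q)_∞,
-- whose iteration expands U_0 = W(1) as −(−q;q)_∞ Σ_{n≥1} (−1)^n q^(n²) / (−q;q²)_n.
--
-- Everything is carried out modulo q^(N+1), where all sums are finite.
module Submission where

open import Defs
open import Algebra using (CommutativeSemiring; module AbelianGroup)
open import Data.Bool using (Bool; true; false; if_then_else_; not; _∧_)
open import Data.Bool.Properties using (∧-assoc; ∧-comm)
open import Data.Nat using (ℕ)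
open import Data.Nat as ℕ using (zero; suc; _∸_; _%_; _≡ᵇ_; _≤ᵇ_; _≤_; z≤n; s≤s; _<_; _⊓_)
import Data.Nat.DivMod as DivMod
open import Data.Nat.ListAction using (sum)
import Data.Nat.Properties as ℕₚ
open import Data.Nat.Solver using () renaming (module +-*-Solver to ℕSolver)
open import Data.Integer as ℤ using (ℤ; +_)
import Data.Integer.Properties as ℤₚ
open import Data.Integer.Solver using () renaming (module +-*-Solver to ℤSolver)
open import Data.List using (List; []; _∷_; _++_; map; length; filterᵇ; applyUpTo)
open import Data.List.Relation.Unary.All as All using (All; []; _∷_)
import Data.List.Relation.Unary.All.Properties as All
open import Data.Product using (_,_)
open import Function using (_∘_)
open import Relation.Binary.PropositionalEquality using (_≡_)
import Relation.Binary.PropositionalEquality as ≡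
open import Relation.Nullary using (Dec; yes; no; contradiction)
open import Algebra.Properties.Group (AbelianGroup.group ℤₚ.+-0-abelianGroup) using () renaming (∙-cancelʳ to ℤ+-cancelʳ)
import Algebra.Solver.Ring.NaturalCoefficients.Default as SemiringSolver
import Relation.Binary.Reasoning.Setoid as SetoidReasoning

-- Telescoping q-series over an abstract semiring

-- The conjugate of a partition into r distinct parts uses every size 1, ..., r, and alt(λ) counts
-- its odd parts. Size i therefore contributes X/(1 - X), where X = q^i for even i and X = y q^i for
-- odd i. The smallest part of λ is the multiplicity of r in the conjugate; requiring it to be odd
-- changes the last factor to X/(1 - X^2), which for odd r is an extra factor 1/(1 + X). These
-- products serve as definitions at y = q^(2j), so y survives only as the index j. At y = 1 they are
-- tied to actual partitions by a recursion in place of the conjugation bijection: subtracting 1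
-- from every part gives E_r = q^r E_r + q^r E_(r-1) for the series E_r of r distinct parts. The
-- algebra lives in a semiring, so an inverse G of 1 - X is known through G = 1 + X G, and signs
-- enter only through the sequence of summands of ψ(-q). Truncation is what makes the rearrangements
-- exact: q^(2N+1) is zero, and with it the boundary terms of the sums and the remainder of the
-- iteration.

2*-suc : ∀ s → 2 ℕ.* suc s ≡ suc (suc (2 ℕ.* s))
2*-suc s = ≡.cong suc (ℕₚ.+-suc s (s ℕ.+ 0))

odd-exponents : ∀ m s → suc (2 ℕ.* suc m) ℕ.+ 2 ℕ.* s ≡ suc (2 ℕ.* m) ℕ.+ 2 ℕ.* suc s
odd-exponents = solve 2 (λ m s → con 1 :+ con 2 :* (con 1 :+ m) :+ con 2 :* s
                              := con 1 :+ con 2 :* m :+ con 2 :* (con 1 :+ s)) ≡.refl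
  where open ℕSolver

suc-square : ∀ n → suc n ℕ.* suc n ≡ suc (2 ℕ.* n) ℕ.+ n ℕ.* n
suc-square = solve 1 (λ n → (con 1 :+ n) :* (con 1 :+ n) := (con 1 :+ con 2 :* n) :+ n :* n) ≡.refl
  where open ℕSolver

module OverSemiring {c ℓ} (R : CommutativeSemiring c ℓ) where
  open CommutativeSemiring R
  open SetoidReasoning setoid
  open SemiringSolver R

  ∑ : ℕ → (ℕ → Carrier) → Carrier
  ∑ zero    f = 0#
  ∑ (suc n) f = ∑ n f + f n

  ∑-cong : ∀ n {f g} → (∀ k → f k ≈ g k) → ∑ n f ≈ ∑ n g
  ∑-cong zero    f≈g = refl
  ∑-cong (suc n) f≈g = +-cong (∑-cong n f≈g) (f≈g n)

  ∑-+ : ∀ n f g → ∑ n (λ k → f k + g k) ≈ ∑ n f + ∑ n g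
  ∑-+ zero    f g = sym (+-identityˡ 0#)
  ∑-+ (suc n) f g = begin
    ∑ n (λ k → f k + g k) + (f n + g n)  ≈⟨ +-congʳ (∑-+ n f g) ⟩
    ∑ n f + ∑ n g + (f n + g n)          ≈⟨ solve 4 (λ a b c d → a :+ b :+ (c :+ d) := a :+ c :+ (b :+ d)) refl _ _ _ _ ⟩
    ∑ n f + f n + (∑ n g + g n)          ∎

  ∑-*ˡ : ∀ n a f → ∑ n (λ k → a * f k) ≈ a * ∑ n f
  ∑-*ˡ zero    a f = sym (zeroʳ a)
  ∑-*ˡ (suc n) a f = trans (+-congʳ (∑-*ˡ n a f)) (sym (distribˡ a _ _))

  ∑-head : ∀ n f → ∑ (suc n) f ≈ f 0 + ∑ n (λ k → f (suc k))
  ∑-head zero    f = +-comm 0# (f 0)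
  ∑-head (suc n) f = trans (+-congʳ (∑-head n f)) (+-assoc _ _ _)

  -- The parameters stand for x m = q^(2m+1), t m = q^(2m), and the inverses g m, v m, h m of
  -- 1 − x m, 1 + x m, 1 − t (m + 1); all equations are written without subtraction.
  module Telescoping
    (x t g v h : ℕ → Carrier)
    (t-zero : t 0 ≈ 1#)
    (x-+    : ∀ j s → x (j ℕ.+ s) ≈ x j * t s)
    (x-suc  : ∀ j s → x (suc (j ℕ.+ s)) * t s ≈ x (j ℕ.+ s) * t (suc s))
    (g-inv  : ∀ m → g m ≈ 1# + x m * g m)
    (v-inv  : ∀ m → v m + x m * v m ≈ 1#)
    (h-inv  : ∀ m → h m ≈ 1# + t (suc m) * h m)
    (K : ℕ)
    (x-vanishes : ∀ j → x (j ℕ.+ K) ≈ 0#)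
    where

    -- The partitions λ into 2s (evenTerm) or 2s + 1 (oddTerm) distinct parts, read off their
    -- conjugates and weighted by q^(|λ| + 2j alt(λ)); restrTerm keeps the odd smallest parts.
    mutual
      evenTerm : ℕ → ℕ → Carrier
      evenTerm j zero    = 1#
      evenTerm j (suc s) = t (suc s) * h s * oddTerm j s

      oddTerm : ℕ → ℕ → Carrier
      oddTerm j s = x (j ℕ.+ s) * g (j ℕ.+ s) * evenTerm j s

    restrTerm : ℕ → ℕ → Carrier
    restrTerm j s = v (j ℕ.+ s) * oddTerm j s

    -- (1 − x j) times a pair of terms at j, and also a pair at j + 1 with the parity offset by
    -- one: this is what makes the sums telescope.
    τ : ℕ → ℕ → Carrier
    τ j zero    = 1#
    τ j (suc s) = g (suc (j ℕ.+ s)) * h s * (x (j ℕ.+ s) * t (suc s)) * τ j s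

    -- A regrouping: `evenTerm j s` contains the factors `g` of index j, ..., j + s - 1. One more,
    -- of index j + s, leaves `g j` times those of index j + 1, ..., j + s, which are the ones in
    -- `τ`.
    g*evenTerm : ∀ j s → g (j ℕ.+ s) * evenTerm j s ≈ g j * τ j s
    g*evenTerm j zero rewrite ℕₚ.+-identityʳ j = refl
    g*evenTerm j (suc s) rewrite ℕₚ.+-suc j s = begin
      g′ * (T * H * (X * G * E))  ≈⟨ solve 6 (λ g′ T H X G E → g′ :* (T :* H :* (X :* G :* E)) := g′ :* H :* (X :* T) :* (G :* E)) refl g′ T H X G E ⟩
      g′ * H * (X * T) * (G * E)  ≈⟨ *-congˡ (g*evenTerm j s) ⟩
      g′ * H * (X * T) * (g j * τ j s)  ≈⟨ solve 3 (λ a b c → a :* (b :* c) := b :* (a :* c)) refl _ _ _ ⟩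
      g j * (g′ * H * (X * T) * τ j s) ∎
      where
      g′ = g (suc (j ℕ.+ s)); T = t (suc s); H = h s
      X = x (j ℕ.+ s); G = g (j ℕ.+ s); E = evenTerm j s

    even+odd : ∀ j s → evenTerm j s + oddTerm j s ≈ g j * τ j s
    even+odd j s = begin
      E + X * G * E     ≈⟨ solve 3 (λ X G E → E :+ X :* G :* E := (con 1 :+ X :* G) :* E) refl X G E ⟩
      (1# + X * G) * E  ≈⟨ *-congʳ (g-inv (j ℕ.+ s)) ⟨
      G * E             ≈⟨ g*evenTerm j s ⟩
      g j * τ j s       ∎
      where
      X = x (j ℕ.+ s); G = g (j ℕ.+ s); E = evenTerm j s

    mutual
      -- Passing from j to j + 1 multiplies the factor `x` of each of the s odd sizes below 2s by
      -- q^2, together q^(2s) = `t s`, and raises the indices of `g` to those in `τ`.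
      evenTerm-suc : ∀ j s → evenTerm (suc j) s ≈ t s * τ j s
      evenTerm-suc j zero    = sym (trans (*-identityʳ _) t-zero)
      evenTerm-suc j (suc s) = begin
        T * H * oddTerm (suc j) s  ≈⟨ *-assoc _ _ _ ⟩
        T * (H * oddTerm (suc j) s)  ≈⟨ *-congˡ (h*oddTerm-suc j s) ⟩
        T * τ j (suc s)  ∎
        where
        T = t (suc s); H = h s

      h*oddTerm-suc : ∀ j s → h s * oddTerm (suc j) s ≈ τ j (suc s)
      h*oddTerm-suc j s = begin
        H * (X′ * G′ * evenTerm (suc j) s)  ≈⟨ *-congˡ (*-congˡ (evenTerm-suc j s)) ⟩
        H * (X′ * G′ * (t s * τ j s))       ≈⟨ solve 5 (λ H X′ G′ t τ → H :* (X′ :* G′ :* (t :* τ)) := G′ :* H :* (X′ :* t) :* τ) refl H X′ G′ (t s) (τ j s) ⟩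
        G′ * H * (X′ * t s) * τ j s         ≈⟨ *-congʳ (*-congˡ (x-suc j s)) ⟩
        τ j (suc s)                         ∎
        where
        H = h s; X′ = x (suc (j ℕ.+ s)); G′ = g (suc (j ℕ.+ s))

    -- The subtraction-free form of `oddTerm (suc j) s` = (1 - t (s + 1)) `τ j (suc s)`.
    odd+t*τ : ∀ j s → oddTerm (suc j) s + t (suc s) * τ j (suc s) ≈ τ j (suc s)
    odd+t*τ j s = begin
      O + T * τ j (suc s)   ≈⟨ +-congˡ (*-congˡ (h*oddTerm-suc j s)) ⟨
      O + T * (H * O)       ≈⟨ solve 3 (λ O T H → O :+ T :* (H :* O) := (con 1 :+ T :* H) :* O) refl O T H ⟩
      (1# + T * H) * O      ≈⟨ *-congʳ (h-inv s) ⟨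
      H * O                 ≈⟨ h*oddTerm-suc j s ⟩
      τ j (suc s)           ∎
      where
      O = oddTerm (suc j) s; T = t (suc s); H = h s

    odd+even-suc : ∀ j s → oddTerm (suc j) s + evenTerm (suc j) (suc s) ≈ τ j (suc s)
    odd+even-suc j s = trans (+-congˡ (evenTerm-suc j (suc s))) (odd+t*τ j s)

    -- This is (1 - x j) `restrTerm j s`. Dividing out `g j` beforehand reduces the factor 1 - (x
    -- j)^2 in the equation for W to 1 + x j, which has no minus sign.
    ω : ℕ → ℕ → Carrier
    ω j s = v (j ℕ.+ s) * x (j ℕ.+ s) * τ j s

    restrTerm≈g*ω : ∀ j s → restrTerm j s ≈ g j * ω j s
    restrTerm≈g*ω j s = begin
      V * (X * G * E)  ≈⟨ solve 4 (λ V X G E → V :* (X :* G :* E) := V :* X :* (G :* E)) refl V X G E ⟩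
      V * X * (G * E)  ≈⟨ *-congˡ (g*evenTerm j s) ⟩
      V * X * (g j * τ j s)  ≈⟨ solve 3 (λ a b c → a :* (b :* c) := b :* (a :* c)) refl _ _ _ ⟩
      g j * (V * X * τ j s)  ∎
      where
      V = v (j ℕ.+ s); X = x (j ℕ.+ s); G = g (j ℕ.+ s); E = evenTerm j s

    ω-zero : ∀ j → ω j 0 + x j * ω j 0 ≈ x j * τ j 0
    ω-zero j rewrite ℕₚ.+-identityʳ j = begin
      V * X * 1# + X * (V * X * 1#)  ≈⟨ solve 2 (λ V X → V :* X :* con 1 :+ X :* (V :* X :* con 1) := X :* (V :+ X :* V)) refl V X ⟩
      X * (V + X * V)                ≈⟨ *-congˡ (v-inv j) ⟩
      X * 1#                         ∎
      where
      V = v j; X = x j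

    -- Here 2s + 3 parts at j meet 2s + 1 parts at j + 1, since both carry the same `v`. Writing x
    -- (j + s + 1) as x j times t (s + 1) exposes the common factor x j and makes `odd+t*τ`
    -- applicable; the remaining 1 + x (j + s + 1) cancels against `v`.
    ω-suc : ∀ j s → ω j (suc s) + x j * ω j (suc s) + x j * restrTerm (suc j) s ≈ x j * τ j (suc s)
    ω-suc j s rewrite ℕₚ.+-suc j s = begin
      V * X * T + a * (V * X * T) + a * (V * O)
        ≈⟨ solve 5 (λ V X T a O → V :* X :* T :+ a :* (V :* X :* T) :+ a :* (V :* O) := V :* T :* X :+ a :* V :* X :* T :+ a :* V :* O) refl V X T a O ⟩
      V * T * X + a * V * X * T + a * V * O
        ≈⟨ +-congʳ (+-congʳ (*-congˡ X≈)) ⟩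
      V * T * (a * u) + a * V * X * T + a * V * O
        ≈⟨ solve 6 (λ V X T a O u → V :* T :* (a :* u) :+ a :* V :* X :* T :+ a :* V :* O := a :* V :* (O :+ u :* T) :+ a :* V :* X :* T) refl V X T a O u ⟩
      a * V * (O + u * T) + a * V * X * T
        ≈⟨ +-congʳ (*-congˡ (odd+t*τ j s)) ⟩
      a * V * T + a * V * X * T
        ≈⟨ solve 4 (λ V X T a → a :* V :* T :+ a :* V :* X :* T := a :* (V :+ X :* V) :* T) refl V X T a ⟩
      a * (V + X * V) * T
        ≈⟨ *-congʳ (*-congˡ (v-inv (suc (j ℕ.+ s)))) ⟩
      a * 1# * T
        ≈⟨ *-congʳ (*-identityʳ a) ⟩
      a * T ∎
      where
      V = v (suc (j ℕ.+ s)); X = x (suc (j ℕ.+ s)); T = τ j (suc s); a = x j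
      O = oddTerm (suc j) s; u = t (suc s)
      X≈ : X ≈ a * u
      X≈ = trans (reflexive (≡.cong x (≡.sym (ℕₚ.+-suc j s)))) (x-+ j (suc s))

    distinct : ℕ → Carrier
    distinct j = ∑ (suc K) (λ s → evenTerm j s + oddTerm j s)

    restricted : ℕ → Carrier
    restricted j = ∑ (suc K) (restrTerm j)

    oddTerm-vanishes : ∀ j → oddTerm j K ≈ 0#
    oddTerm-vanishes j = begin
      x (j ℕ.+ K) * G * E  ≈⟨ *-congʳ (*-congʳ (x-vanishes j)) ⟩
      0# * G * E           ≈⟨ solve 2 (λ G E → con 0 :* G :* E := con 0) refl G E ⟩
      0#                   ∎
      where
      G = g (j ℕ.+ K); E = evenTerm j K

    restrTerm-vanishes : ∀ j → restrTerm j K ≈ 0#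
    restrTerm-vanishes j = trans (*-congˡ (oddTerm-vanishes j)) (zeroʳ _)

    -- The leading 1 stands alone, and each odd term is paired with the even term of the next index.
    -- The cut at `K` is exact because the last odd term, whose partner lies outside the sum,
    -- vanishes.
    distinct-suc : ∀ j → distinct (suc j) ≈ ∑ (suc K) (τ j)
    distinct-suc j = begin
      ∑ K (λ s → e s + o s) + (e K + o K)
        ≈⟨ +-congˡ (trans (+-congˡ (oddTerm-vanishes (suc j))) (+-identityʳ _)) ⟩
      ∑ K (λ s → e s + o s) + e K
        ≈⟨ +-congʳ (∑-+ K e o) ⟩
      ∑ K e + ∑ K o + e K
        ≈⟨ solve 3 (λ a b c → a :+ b :+ c := a :+ c :+ b) refl _ _ _ ⟩
      ∑ (suc K) e + ∑ K o
        ≈⟨ +-congʳ (∑-head K e) ⟩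
      1# + ∑ K (λ s → e (suc s)) + ∑ K o
        ≈⟨ solve 3 (λ a b c → a :+ b :+ c := a :+ (c :+ b)) refl _ _ _ ⟩
      1# + (∑ K o + ∑ K (λ s → e (suc s)))
        ≈⟨ +-congˡ (∑-+ K o (λ s → e (suc s))) ⟨
      1# + ∑ K (λ s → o s + e (suc s))
        ≈⟨ +-congˡ (∑-cong K (odd+even-suc j)) ⟩
      1# + ∑ K (λ s → τ j (suc s))
        ≈⟨ ∑-head K (τ j) ⟨
      ∑ (suc K) (τ j) ∎
      where
      e = evenTerm (suc j); o = oddTerm (suc j)

    distinct-step : ∀ j → distinct j ≈ g j * distinct (suc j)
    distinct-step j = begin
      distinct j                     ≈⟨ ∑-cong (suc K) (even+odd j) ⟩
      ∑ (suc K) (λ s → g j * τ j s)  ≈⟨ ∑-*ˡ (suc K) (g j) (τ j) ⟩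
      g j * ∑ (suc K) (τ j)          ≈⟨ *-congˡ (distinct-suc j) ⟨
      g j * distinct (suc j)         ∎

    restricted≈g*ω : ∀ j → restricted j ≈ g j * ∑ (suc K) (ω j)
    restricted≈g*ω j = trans (∑-cong (suc K) (restrTerm≈g*ω j)) (∑-*ˡ (suc K) (g j) (ω j))

    ω-sum : ∀ j → let Ω = ∑ (suc K) (ω j) in
            Ω + x j * Ω + x j * restricted (suc j) ≈ x j * distinct (suc j)
    ω-sum j = begin
      Ω + a * Ω + a * (∑ K r + r K)
        ≈⟨ +-congˡ (*-congˡ (trans (+-congˡ (restrTerm-vanishes (suc j))) (+-identityʳ _))) ⟩
      Ω + a * Ω + a * ∑ K r
        ≈⟨ +-congʳ (+-cong (∑-head K (ω j)) (*-congˡ (∑-head K (ω j)))) ⟩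
      (ω j 0 + Ω′) + a * (ω j 0 + Ω′) + a * ∑ K r
        ≈⟨ solve 4 (λ w Ω′ a S → (w :+ Ω′) :+ a :* (w :+ Ω′) :+ a :* S := (w :+ a :* w) :+ (Ω′ :+ a :* Ω′ :+ a :* S)) refl _ _ _ _ ⟩
      (ω j 0 + a * ω j 0) + (Ω′ + a * Ω′ + a * ∑ K r)
        ≈⟨ +-cong (ω-zero j) tail ⟩
      a * τ j 0 + a * ∑ K (λ s → τ j (suc s))
        ≈⟨ distribˡ a _ _ ⟨
      a * (τ j 0 + ∑ K (λ s → τ j (suc s)))
        ≈⟨ *-congˡ (∑-head K (τ j)) ⟨
      a * ∑ (suc K) (τ j)
        ≈⟨ *-congˡ (distinct-suc j) ⟨
      a * distinct (suc j) ∎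
      where
      a = x j; r = restrTerm (suc j)
      ω′ : ℕ → Carrier
      ω′ s = ω j (suc s)
      Ω = ∑ (suc K) (ω j); Ω′ = ∑ K ω′
      tail : Ω′ + a * Ω′ + a * ∑ K r ≈ a * ∑ K (λ s → τ j (suc s))
      tail = begin
        Ω′ + a * Ω′ + a * ∑ K r
          ≈⟨ +-cong (+-congˡ (∑-*ˡ K a ω′)) (∑-*ˡ K a r) ⟨
        Ω′ + ∑ K (λ s → a * ω′ s) + ∑ K (λ s → a * r s)
          ≈⟨ +-congʳ (∑-+ K ω′ (λ s → a * ω′ s)) ⟨
        ∑ K (λ s → ω′ s + a * ω′ s) + ∑ K (λ s → a * r s)
          ≈⟨ ∑-+ K (λ s → ω′ s + a * ω′ s) (λ s → a * r s) ⟨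
        ∑ K (λ s → ω′ s + a * ω′ s + a * r s)
          ≈⟨ ∑-cong K (ω-suc j) ⟩
        ∑ K (λ s → a * τ j (suc s))
          ≈⟨ ∑-*ˡ K a (λ s → τ j (suc s)) ⟩
        a * ∑ K (λ s → τ j (suc s)) ∎

    ∏g : ℕ → Carrier
    ∏g zero    = 1#
    ∏g (suc j) = ∏g j * g j

    ∏g*distinct : ∀ j → ∏g j * distinct j ≈ distinct 0
    ∏g*distinct zero    = *-identityˡ _
    ∏g*distinct (suc j) = begin
      ∏g j * g j * distinct (suc j)    ≈⟨ *-assoc _ _ _ ⟩
      ∏g j * (g j * distinct (suc j))  ≈⟨ *-congˡ (distinct-step j) ⟨
      ∏g j * distinct j                ≈⟨ ∏g*distinct j ⟩
      distinct 0                       ∎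

    U : ℕ → Carrier
    U j = ∏g j * restricted j

    U-step : ∀ j → U j + x j * v j * U (suc j) ≈ x j * v j * distinct 0
    U-step j = begin
      U j + a * V * U (suc j)
        -- Inserting 1 = v j (1 + x j) produces the factor 1 + x j that `ω-sum` carries.
        ≈⟨ +-congʳ (trans (sym (*-identityˡ _)) (*-congʳ (sym (v-inv j)))) ⟩
      (V + a * V) * U j + a * V * U (suc j)
        ≈⟨ +-congʳ (*-congˡ U≈) ⟩
      (V + a * V) * (Π * Ω) + a * V * (Π * S)
        ≈⟨ solve 5 (λ V a Π Ω S → (V :+ a :* V) :* (Π :* Ω) :+ a :* V :* (Π :* S) := V :* Π :* (Ω :+ a :* Ω :+ a :* S)) refl V a Π Ω S ⟩
      V * Π * (Ω + a * Ω + a * S)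
        ≈⟨ *-congˡ (ω-sum j) ⟩
      V * Π * (a * distinct (suc j))
        ≈⟨ solve 4 (λ V Π a D → V :* Π :* (a :* D) := a :* V :* (Π :* D)) refl V Π a _ ⟩
      a * V * (Π * distinct (suc j))
        ≈⟨ *-congˡ (∏g*distinct (suc j)) ⟩
      a * V * distinct 0 ∎
      where
      a = x j; V = v j; Π = ∏g (suc j); Ω = ∑ (suc K) (ω j); S = restricted (suc j)
      U≈ : U j ≈ Π * Ω
      U≈ = trans (*-congˡ (restricted≈g*ω j)) (sym (*-assoc _ _ _))

    module _ (P : ℕ → Carrier)
      (P-zero : P 0 ≈ 1#)
      (P-suc : ∀ n → P (suc n) + x n * v n * P n ≈ 0#)
      where

      -- Solving `U-step` for `U n` and substituting n times leaves the remainder `P n * U n`,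
      -- because `P n` is the product of the factors -x k v k with k < n.
      partialSum : ∀ n → restricted 0 + ∑ n (λ k → P (suc k)) * distinct 0 ≈ P n * U n
      partialSum zero = begin
        restricted 0 + 0# * distinct 0  ≈⟨ solve 2 (λ r d → r :+ con 0 :* d := con 1 :* (con 1 :* r)) refl _ _ ⟩
        1# * (1# * restricted 0)        ≈⟨ *-congʳ P-zero ⟨
        P 0 * U 0                       ∎
      partialSum (suc n) = begin
        restricted 0 + (S + P′) * D
          ≈⟨ solve 4 (λ r S P′ D → r :+ (S :+ P′) :* D := r :+ S :* D :+ P′ :* D) refl _ S P′ D ⟩
        restricted 0 + S * D + P′ * D
          ≈⟨ +-congʳ (partialSum n) ⟩
        p * U n + P′ * D
          ≈⟨ +-identityʳ _ ⟨
        p * U n + P′ * D + 0#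
          -- The inserted zero has two halves: y p U (n + 1) completes the left side of `U-step`,
          -- and P′ U (n + 1) is the next remainder.
          ≈⟨ +-congˡ (trans (*-congʳ (P-suc n)) (zeroˡ _)) ⟨
        p * U n + P′ * D + (P′ + y * p) * U (suc n)
          ≈⟨ solve 6 (λ p u P′ D y u′ → p :* u :+ P′ :* D :+ (P′ :+ y :* p) :* u′ := p :* (u :+ y :* u′) :+ P′ :* D :+ P′ :* u′) refl p (U n) P′ D y (U (suc n)) ⟩
        p * (U n + y * U (suc n)) + P′ * D + P′ * U (suc n)
          ≈⟨ +-congʳ (+-congʳ (*-congˡ (U-step n))) ⟩
        p * (y * D) + P′ * D + P′ * U (suc n)
          ≈⟨ solve 5 (λ p P′ D y u′ → p :* (y :* D) :+ P′ :* D :+ P′ :* u′ := (P′ :+ y :* p) :* D :+ P′ :* u′) refl p P′ D y (U (suc n)) ⟩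
        (P′ + y * p) * D + P′ * U (suc n)
          ≈⟨ +-congʳ (trans (*-congʳ (P-suc n)) (zeroˡ _)) ⟩
        0# + P′ * U (suc n)
          ≈⟨ +-identityˡ _ ⟩
        P′ * U (suc n) ∎
        where
        S = ∑ n (λ k → P (suc k)); P′ = P (suc n); p = P n; D = distinct 0; y = x n * v n

      P-vanishes : P (suc K) ≈ 0#
      P-vanishes = begin
        P (suc K)                        ≈⟨ +-identityʳ _ ⟨
        P (suc K) + 0#                   ≈⟨ +-congˡ (trans (*-congʳ (trans (*-congʳ (x-vanishes 0)) (zeroˡ _))) (zeroˡ _)) ⟨
        P (suc K) + x K * v K * P K      ≈⟨ P-suc K ⟩
        0#                               ∎

      restricted+∑P*distinct≈0 : restricted 0 + ∑ (suc K) (λ k → P (suc k)) * distinct 0 ≈ 0#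
      restricted+∑P*distinct≈0 = trans (partialSum (suc K)) (trans (*-congʳ P-vanishes) (zeroˡ _))

-- Generating functions of distinct parts

  module DistinctParts (q^ : ℕ → Carrier) where

    -- The series below enumerate the subsets of {a, …, a + K − 1} by their sum.
    bySize : ℕ → ℕ → ℕ → Carrier
    bySize a zero    zero    = 1#
    bySize a zero    (suc r) = 0#
    bySize a (suc K) zero    = 1#
    bySize a (suc K) (suc r) = bySize (suc a) K (suc r) + q^ a * bySize (suc a) K r

    q^ifOdd : ℕ → Carrier
    q^ifOdd a = if oddᵇ a then q^ a else 0#

    bySizeMinOdd : ℕ → ℕ → ℕ → Carrier
    bySizeMinOdd a zero    r       = 0#
    bySizeMinOdd a (suc K) zero    = 0#
    bySizeMinOdd a (suc K) (suc r) = bySizeMinOdd (suc a) K (suc r) + q^ifOdd a * bySize (suc a) K r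

    byParity : Bool → ℕ → ℕ → Carrier
    byParity odd a zero    = if odd then 0# else 1#
    byParity odd a (suc K) = byParity odd (suc a) K + q^ a * byParity (not odd) (suc a) K

    oddMinOdd : ℕ → ℕ → Carrier
    oddMinOdd a zero    = 0#
    oddMinOdd a (suc K) = oddMinOdd (suc a) K + q^ifOdd a * byParity false (suc a) K

    ∏1+q^ : ℕ → ℕ → Carrier
    ∏1+q^ a zero    = 1#
    ∏1+q^ a (suc K) = ∏1+q^ (suc a) K + q^ a * ∏1+q^ (suc a) K

    -- `∏1+q^` recurses on its lowest factor, like the enumeration of subsets, while `prodPlus`
    -- recurses on its highest; this reconciles the two.
    ∏1+q^-last : ∀ a K → ∏1+q^ a (suc K) ≈ ∏1+q^ a K * (1# + q^ (a ℕ.+ K))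
    ∏1+q^-last a zero rewrite ℕₚ.+-identityʳ a = solve 1 (λ q → con 1 :+ q :* con 1 := con 1 :* (con 1 :+ q)) refl (q^ a)
    ∏1+q^-last a (suc K) rewrite ℕₚ.+-suc a K = begin
      ∏1+q^ (suc a) (suc K) + q^ a * ∏1+q^ (suc a) (suc K)  ≈⟨ +-cong ih (*-congˡ ih) ⟩
      D * u + q^ a * (D * u)                                ≈⟨ solve 3 (λ D u q → D :* u :+ q :* (D :* u) := (D :+ q :* D) :* u) refl D u (q^ a) ⟩
      (D + q^ a * D) * u                                    ∎
      where
      D = ∏1+q^ (suc a) K; u = 1# + q^ (suc a ℕ.+ K)
      ih = ∏1+q^-last (suc a) K

    module _ (q^0 : q^ 0 ≈ 1#) (q^-+ : ∀ a b → q^ a * q^ b ≈ q^ (a ℕ.+ b))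
      (N : ℕ) (q^-vanishes : ∀ {m} → N < m → q^ m ≈ 0#)
      (+-cancelʳ : ∀ h {f g} → f + h ≈ g + h → f ≈ g)
      (geom : ℕ → Carrier) (geom-inverse : ∀ m → geom (suc m) ≈ 1# + q^ (suc m) * geom (suc m))
      where

      q^-* : ∀ {a b c} → a ℕ.+ b ≡ c → q^ a * q^ b ≈ q^ c
      q^-* {a} {b} ≡.refl = q^-+ a b

      -- Division by 1 - X without subtraction: y + X G y is G y by the equation for G, and
      -- expanding G y by the equation for y gives G b + X G y, so X G y can be cancelled.
      solve-geometric : ∀ {G X b y} → G ≈ 1# + X * G → y ≈ X * y + b → y ≈ G * b
      solve-geometric {G} {X} {b} {y} G≈ y≈ = +-cancelʳ (X * G * y) (begin
        y + X * G * y            ≈⟨ solve 3 (λ y X G → y :+ X :* G :* y := (con 1 :+ X :* G) :* y) refl y X G ⟩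
        (1# + X * G) * y        ≈⟨ *-congʳ G≈ ⟨
        G * y                    ≈⟨ *-congˡ y≈ ⟩
        G * (X * y + b)          ≈⟨ solve 4 (λ y X G b → G :* (X :* y :+ b) := G :* b :+ X :* G :* y) refl y X G b ⟩
        G * b + X * G * y        ∎)

      bySize-zero : ∀ a K → bySize a K 0 ≈ 1#
      bySize-zero a zero    = refl
      bySize-zero a (suc K) = refl

      -- Raising each of the r elements of a subset by 1 multiplies its weight by q^r.
      bySize-shift : ∀ a K r → bySize (suc a) K r ≈ q^ r * bySize a K r
      bySize-shift a zero    zero    = sym (trans (*-congʳ q^0) (*-identityˡ 1#))
      bySize-shift a (suc K) zero    = sym (trans (*-congʳ q^0) (*-identityˡ 1#))
      bySize-shift a zero    (suc r) = sym (zeroʳ _)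
      bySize-shift a (suc K) (suc r) = begin
        bySize (2 ℕ.+ a) K (suc r) + q^ (suc a) * bySize (2 ℕ.+ a) K r
          ≈⟨ +-cong (bySize-shift (suc a) K (suc r)) (*-congˡ (bySize-shift (suc a) K r)) ⟩
        q^ (suc r) * e + q^ (suc a) * (q^ r * e′)
          ≈⟨ +-congˡ (*-assoc _ _ _) ⟨
        q^ (suc r) * e + q^ (suc a) * q^ r * e′
          ≈⟨ +-congˡ (*-congʳ (trans (q^-* (≡.cong suc (ℕₚ.+-comm a r))) (sym (q^-* ≡.refl)))) ⟩
        q^ (suc r) * e + q^ (suc r) * q^ a * e′
          ≈⟨ solve 4 (λ x e y e′ → x :* e :+ x :* y :* e′ := x :* (e :+ y :* e′)) refl _ _ _ _ ⟩
        q^ (suc r) * (e + q^ a * e′) ∎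
        where
        e = bySize (suc a) K (suc r); e′ = bySize (suc a) K r

      -- The additional subsets contain a + K, so their weights are multiples of a vanishing power
      -- of q. This lets a shifted range be compared with the original one.
      bySize-stable : ∀ a K r → N < a ℕ.+ K → bySize a (suc K) r ≈ bySize a K r
      bySize-stable a zero    zero    N<a   = refl
      bySize-stable a (suc K) zero    N<a   = refl
      bySize-stable a zero    (suc r) N<a   = begin
        0# + q^ a * bySize (suc a) 0 r  ≈⟨ +-identityˡ _ ⟩
        q^ a * bySize (suc a) 0 r          ≈⟨ *-congʳ (q^-vanishes (≡.subst (N <_) (ℕₚ.+-identityʳ a) N<a)) ⟩
        0# * bySize (suc a) 0 r         ≈⟨ zeroˡ _ ⟩
        0#                              ∎
      bySize-stable a (suc K) (suc r) N<a+K = +-cong (bySize-stable (suc a) K (suc r) N<) (*-congˡ (bySize-stable (suc a) K r N<))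
        where N< = ≡.subst (N <_) (ℕₚ.+-suc a K) N<a+K

      bySizeMinOdd-shift : ∀ a K r → bySizeMinOdd (2 ℕ.+ a) K r ≈ q^ r * q^ r * bySizeMinOdd a K r
      bySizeMinOdd-shift a zero    r       = sym (zeroʳ _)
      bySizeMinOdd-shift a (suc K) zero    = sym (zeroʳ _)
      bySizeMinOdd-shift a (suc K) (suc r) = begin
        bySizeMinOdd (3 ℕ.+ a) K (suc r) + q^ifOdd (2 ℕ.+ a) * bySize (3 ℕ.+ a) K r
          ≈⟨ +-cong (bySizeMinOdd-shift (suc a) K (suc r)) (*-congˡ (trans (bySize-shift (2 ℕ.+ a) K r) (*-congˡ (bySize-shift (suc a) K r)))) ⟩
        x * x * w + q^ifOdd (2 ℕ.+ a) * (y * (y * e))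
          ≈⟨ +-congˡ (*-congʳ (ifOdd a)) ⟩
        x * x * w + q^ 1 * q^ 1 * o * (y * (y * e))
          ≈⟨ +-congˡ (solve 4 (λ q y o e → q :* q :* o :* (y :* (y :* e)) := (q :* y) :* (q :* y) :* o :* e) refl (q^ 1) y o e) ⟩
        x * x * w + (q^ 1 * y) * (q^ 1 * y) * o * e
          ≈⟨ +-congˡ (*-congʳ (*-congʳ (*-cong (q^-* ≡.refl) (q^-* ≡.refl)))) ⟩
        x * x * w + x * x * o * e
          ≈⟨ solve 4 (λ x w o e → x :* x :* w :+ x :* x :* o :* e := x :* x :* (w :+ o :* e)) refl x w o e ⟩
        x * x * (w + o * e) ∎
        where
        x = q^ (suc r); y = q^ r; o = q^ifOdd a
        w = bySizeMinOdd (suc a) K (suc r); e = bySize (suc a) K r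
        ifOdd : ∀ a → q^ifOdd (2 ℕ.+ a) ≈ q^ 1 * q^ 1 * q^ifOdd a
        ifOdd a with oddᵇ a
        ... | true  = sym (trans (*-congʳ (q^-* ≡.refl)) (q^-* ≡.refl))
        ... | false = sym (zeroʳ _)

      bySizeMinOdd-stable : ∀ a K r → N < a ℕ.+ K → bySizeMinOdd a (suc K) r ≈ bySizeMinOdd a K r
      bySizeMinOdd-stable a zero    zero    N<a   = refl
      bySizeMinOdd-stable a (suc K) zero    N<a   = refl
      bySizeMinOdd-stable a zero    (suc r) N<a   = begin
        0# + q^ifOdd a * bySize (suc a) 0 r  ≈⟨ +-identityˡ _ ⟩
        q^ifOdd a * bySize (suc a) 0 r          ≈⟨ *-congʳ vanishes ⟩
        0# * bySize (suc a) 0 r              ≈⟨ zeroˡ _ ⟩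
        0#                                   ∎
        where
        vanishes : q^ifOdd a ≈ 0#
        vanishes with oddᵇ a
        ... | true  = q^-vanishes (≡.subst (N <_) (ℕₚ.+-identityʳ a) N<a)
        ... | false = refl
      bySizeMinOdd-stable a (suc K) (suc r) N<a+K = +-cong (bySizeMinOdd-stable (suc a) K (suc r) N<) (*-congˡ (bySize-stable (suc a) K r N<))
        where N< = ≡.subst (N <_) (ℕₚ.+-suc a K) N<a+K

      E W : ℕ → Carrier
      E r = bySize 1 N r
      W r = bySizeMinOdd 1 N r

      -- Subtract 1 from every part; a part 1 disappears.
      E-suc : ∀ r → E (suc r) ≈ q^ (suc r) * E (suc r) + q^ (suc r) * E r
      E-suc r = begin
        bySize 1 N (suc r)                                   ≈⟨ bySize-stable 1 N (suc r) ℕₚ.≤-refl ⟨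
        bySize 2 N (suc r) + q^ 1 * bySize 2 N r             ≈⟨ +-cong (bySize-shift 1 N (suc r)) (*-congˡ (bySize-shift 1 N r)) ⟩
        q^ (suc r) * E (suc r) + q^ 1 * (q^ r * E r)         ≈⟨ +-congˡ (*-assoc _ _ _) ⟨
        q^ (suc r) * E (suc r) + q^ 1 * q^ r * E r           ≈⟨ +-congˡ (*-congʳ (q^-* ≡.refl)) ⟩
        q^ (suc r) * E (suc r) + q^ (suc r) * E r            ∎

      -- If 1 is not a part then the parts are at least 3, and subtracting 2 keeps the parity.
      W-suc : ∀ r → W (suc r) ≈ q^ (suc r) * q^ (suc r) * W (suc r) + q^ (suc r) * E r
      W-suc r = begin
        bySizeMinOdd 1 N (suc r)
          ≈⟨ bySizeMinOdd-stable 1 N (suc r) ℕₚ.≤-refl ⟨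
        bySizeMinOdd 1 (suc N) (suc r)
          ≈⟨ bySizeMinOdd-stable 1 (suc N) (suc r) (ℕₚ.m<n⇒m<1+n ℕₚ.≤-refl) ⟨
        bySizeMinOdd 3 N (suc r) + 0# * bySize 3 N r + q^ 1 * bySize 2 (suc N) r
          ≈⟨ +-cong (trans (+-congˡ (zeroˡ _)) (+-identityʳ _)) (*-congˡ (bySize-stable 2 N r (ℕₚ.m<n⇒m<1+n ℕₚ.≤-refl))) ⟩
        bySizeMinOdd 3 N (suc r) + q^ 1 * bySize 2 N r
          ≈⟨ +-cong (bySizeMinOdd-shift 1 N (suc r)) (*-congˡ (bySize-shift 1 N r)) ⟩
        q^ (suc r) * q^ (suc r) * W (suc r) + q^ 1 * (q^ r * E r)
          ≈⟨ +-congˡ (*-assoc _ _ _) ⟨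
        q^ (suc r) * q^ (suc r) * W (suc r) + q^ 1 * q^ r * E r
          ≈⟨ +-congˡ (*-congʳ (q^-* ≡.refl)) ⟩
        q^ (suc r) * q^ (suc r) * W (suc r) + q^ (suc r) * E r ∎

      -- Subtracting 1 from every part turns an even smallest part into an odd one, which explains
      -- the second summand. The proof uses uniqueness: both sides solve y = X y + X `E r`.
      E≈W : ∀ r → E (suc r) ≈ W (suc r) + q^ (suc r) * W (suc r)
      E≈W r = trans (solve-geometric G≈ (E-suc r)) (sym (solve-geometric G≈ eq))
        where
        G≈ = geom-inverse r
        X = q^ (suc r)
        eq : W (suc r) + X * W (suc r) ≈ X * (W (suc r) + X * W (suc r)) + X * E r
        eq = begin
          W (suc r) + X * W (suc r)
            ≈⟨ +-congʳ (W-suc r) ⟩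
          X * X * W (suc r) + X * E r + X * W (suc r)
            ≈⟨ solve 3 (λ X w e → X :* X :* w :+ X :* e :+ X :* w := X :* (w :+ X :* w) :+ X :* e) refl X _ _ ⟩
          X * (W (suc r) + X * W (suc r)) + X * E r ∎

      bySize-vanishes : ∀ a K r → K < r → bySize a K r ≈ 0#
      bySize-vanishes a zero    (suc r) _         = refl
      bySize-vanishes a (suc K) (suc r) (s≤s K<r) = begin
        bySize (suc a) K (suc r) + q^ a * bySize (suc a) K r  ≈⟨ +-cong (bySize-vanishes (suc a) K (suc r) (ℕₚ.m<n⇒m<1+n K<r)) (*-congˡ (bySize-vanishes (suc a) K r K<r)) ⟩
        0# + q^ a * 0#                                  ≈⟨ trans (+-identityˡ _) (zeroʳ _) ⟩
        0#                                                 ∎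

      ∑-0# : ∀ n → ∑ n (λ _ → 0#) ≈ 0#
      ∑-0# zero    = refl
      ∑-0# (suc n) = trans (+-identityʳ _) (∑-0# n)

      ∑-linear : ∀ n a f g → ∑ n (λ k → f k + a * g k) ≈ ∑ n f + a * ∑ n g
      ∑-linear n a f g = trans (∑-+ n f (λ k → a * g k)) (+-congˡ (∑-*ˡ n a g))

      mutual
        -- A subset of a K-element range has at most K elements, so K ≤ S guarantees that no odd
        -- size is missed.
        ∑-odd : ∀ S a K → K ≤ S → ∑ (suc S) (λ s → bySize a K (suc (2 ℕ.* s))) ≈ byParity true a K
        ∑-odd S a zero    K≤S = ∑-0# (suc S)
        ∑-odd S a (suc K) K<S = trans (∑-linear (suc S) (q^ a) _ _)
          (+-cong (∑-odd S (suc a) K K≤S) (*-congˡ (∑-even S (suc a) K K≤S)))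
          where K≤S = ℕₚ.<⇒≤ K<S

        ∑-even : ∀ S a K → K ≤ S → ∑ (suc S) (λ s → bySize a K (2 ℕ.* s)) ≈ byParity false a K
        ∑-even S a zero    K≤S = begin
          ∑ (suc S) (λ s → bySize a 0 (2 ℕ.* s))   ≈⟨ ∑-head S _ ⟩
          1# + ∑ S (λ _ → 0#)                  ≈⟨ trans (+-congˡ (∑-0# S)) (+-identityʳ _) ⟩
          1#                                      ∎
        ∑-even S a (suc K) K<S = begin
          ∑ (suc S) (λ s → bySize a (suc K) (2 ℕ.* s))
            ≈⟨ ∑-head S _ ⟩
          1# + ∑ S (λ s → bySize a (suc K) (2 ℕ.* suc s))
            ≈⟨ +-congˡ (∑-cong S (λ s → reflexive (≡.cong (bySize a (suc K)) (2*-suc s)))) ⟩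
          1# + ∑ S (λ s → bySize (suc a) K (suc (suc (2 ℕ.* s))) + q^ a * o s)
            ≈⟨ +-cong (sym (bySize-zero (suc a) K)) (∑-linear S (q^ a) _ _) ⟩
          bySize (suc a) K 0 + (∑ S (λ s → bySize (suc a) K (suc (suc (2 ℕ.* s)))) + q^ a * ∑ S o)
            ≈⟨ solve 3 (λ a b c → a :+ (b :+ c) := a :+ b :+ c) refl _ _ _ ⟩
          bySize (suc a) K 0 + ∑ S (λ s → bySize (suc a) K (suc (suc (2 ℕ.* s)))) + q^ a * ∑ S o
            ≈⟨ +-cong (+-congˡ (∑-cong S (λ s → reflexive (≡.cong (bySize (suc a) K) (≡.sym (2*-suc s)))))) (*-congˡ lastTerm) ⟩
          bySize (suc a) K 0 + ∑ S (λ s → bySize (suc a) K (2 ℕ.* suc s)) + q^ a * ∑ (suc S) o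
            ≈⟨ +-congʳ (∑-head S (λ s → bySize (suc a) K (2 ℕ.* s))) ⟨
          ∑ (suc S) (λ s → bySize (suc a) K (2 ℕ.* s)) + q^ a * ∑ (suc S) o
            ≈⟨ +-cong (∑-even S (suc a) K K≤S) (*-congˡ (∑-odd S (suc a) K K≤S)) ⟩
          byParity false (suc a) K + q^ a * byParity true (suc a) K ∎
          where
          K≤S = ℕₚ.<⇒≤ K<S
          o : ℕ → Carrier
          o s = bySize (suc a) K (suc (2 ℕ.* s))
          -- Splitting off the empty set costs the odd sum its last index; the size 2S + 1 lost
          -- there exceeds K, so its series is zero.
          lastTerm : ∑ S o ≈ ∑ (suc S) o
          lastTerm = sym (trans (+-congˡ (bySize-vanishes (suc a) K _ (s≤s (ℕₚ.≤-trans K≤S (ℕₚ.m≤m+n S _))))) (+-identityʳ _))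

      ∑-minOdd : ∀ S a K → K ≤ S → ∑ (suc S) (λ s → bySizeMinOdd a K (suc (2 ℕ.* s))) ≈ oddMinOdd a K
      ∑-minOdd S a zero    K≤S = ∑-0# (suc S)
      ∑-minOdd S a (suc K) K<S = trans (∑-linear (suc S) (q^ifOdd a) _ _)
        (+-cong (∑-minOdd S (suc a) K K≤S) (*-congˡ (∑-even S (suc a) K K≤S)))
        where K≤S = ℕₚ.<⇒≤ K<S

      byParity-sum : ∀ a K → byParity false a K + byParity true a K ≈ ∏1+q^ a K
      byParity-sum a zero    = +-identityʳ 1#
      byParity-sum a (suc K) = begin
        (f + q^ a * t) + (t + q^ a * f)  ≈⟨ solve 3 (λ f t q → (f :+ q :* t) :+ (t :+ q :* f) := (f :+ t) :+ q :* (f :+ t)) refl f t (q^ a) ⟩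
        (f + t) + q^ a * (f + t)         ≈⟨ +-cong ih (*-congˡ ih) ⟩
        ∏1+q^ a (suc K)                  ∎
        where
        f = byParity false (suc a) K; t = byParity true (suc a) K
        ih = byParity-sum (suc a) K

      module _ (v : ℕ → Carrier) (v-inverse : ∀ m → v m + q^ (suc (2 ℕ.* m)) * v m ≈ 1#)
        (P : ℕ → Carrier) (P-zero : P 0 ≈ 1#)
        (P-suc : ∀ n → P (suc n) + q^ (suc (2 ℕ.* n)) * v n * P n ≈ 0#)
        where

        x-suc : ∀ j s → q^ (suc (2 ℕ.* suc (j ℕ.+ s))) * q^ (2 ℕ.* s) ≈ q^ (suc (2 ℕ.* (j ℕ.+ s))) * q^ (2 ℕ.* suc s)
        x-suc j s = trans (q^-* (odd-exponents (j ℕ.+ s) s)) (sym (q^-* ≡.refl))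

        module Tel = Telescoping
          (λ m → q^ (suc (2 ℕ.* m))) (λ m → q^ (2 ℕ.* m)) (λ m → geom (suc (2 ℕ.* m))) v (λ m → geom (2 ℕ.* suc m))
          q^0
          (λ j s → sym (q^-* (≡.cong suc (≡.sym (ℕₚ.*-distribˡ-+ 2 j s)))))
          x-suc
          (λ m → geom-inverse (2 ℕ.* m))
          v-inverse
          (λ m → geom-inverse _)
          N
          (λ j → q^-vanishes (s≤s (ℕₚ.≤-trans (ℕₚ.m≤n+m N j) (ℕₚ.m≤m+n (j ℕ.+ N) _))))

        -- The factor q^(r+1)/(1 - q^(r+1)) is the contribution of size r + 1 to the conjugate, so
        -- `E` satisfies the recursion that defines the terms at j = 0.
        E-geom : ∀ r → E (suc r) ≈ q^ (suc r) * geom (suc r) * E r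
        E-geom r = trans (solve-geometric (geom-inverse r) (E-suc r))
                         (solve 3 (λ g x e → g :* (x :* e) := x :* g :* e) refl _ _ _)

        mutual
          evenTerm≈E : ∀ s → Tel.evenTerm 0 s ≈ E (2 ℕ.* s)
          evenTerm≈E zero    = sym (bySize-zero 1 N)
          evenTerm≈E (suc s) = sym (trans (E-geom _) (*-congˡ
            (trans (reflexive (≡.cong E (ℕₚ.+-suc s (s ℕ.+ 0)))) (sym (oddTerm≈E s)))))

          oddTerm≈E : ∀ s → Tel.oddTerm 0 s ≈ E (suc (2 ℕ.* s))
          oddTerm≈E s = trans (*-congˡ (evenTerm≈E s)) (sym (E-geom (2 ℕ.* s)))

        restrTerm≈W : ∀ s → Tel.restrTerm 0 s ≈ W (suc (2 ℕ.* s))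
        restrTerm≈W s = begin
          v s * Tel.oddTerm 0 s  ≈⟨ *-congˡ (trans (oddTerm≈E s) (E≈W (2 ℕ.* s))) ⟩
          v s * (w + x * w)      ≈⟨ solve 3 (λ v w x → v :* (w :+ x :* w) := (v :+ x :* v) :* w) refl (v s) w x ⟩
          (v s + x * v s) * w    ≈⟨ trans (*-congʳ (v-inverse s)) (*-identityˡ w) ⟩
          w                      ∎
          where
          w = W (suc (2 ℕ.* s)); x = q^ (suc (2 ℕ.* s))

        distinct≈∏ : Tel.distinct 0 ≈ ∏1+q^ 1 N
        distinct≈∏ = begin
          ∑ (suc N) (λ s → Tel.evenTerm 0 s + Tel.oddTerm 0 s)
            ≈⟨ ∑-+ (suc N) (Tel.evenTerm 0) (Tel.oddTerm 0) ⟩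
          ∑ (suc N) (Tel.evenTerm 0) + ∑ (suc N) (Tel.oddTerm 0)
            ≈⟨ +-cong (∑-cong (suc N) evenTerm≈E) (∑-cong (suc N) oddTerm≈E) ⟩
          ∑ (suc N) (λ s → E (2 ℕ.* s)) + ∑ (suc N) (λ s → E (suc (2 ℕ.* s)))
            ≈⟨ +-cong (∑-even N 1 N ℕₚ.≤-refl) (∑-odd N 1 N ℕₚ.≤-refl) ⟩
          byParity false 1 N + byParity true 1 N
            ≈⟨ byParity-sum 1 N ⟩
          ∏1+q^ 1 N ∎

        restricted≈oddMinOdd : Tel.restricted 0 ≈ oddMinOdd 1 N
        restricted≈oddMinOdd = trans (∑-cong (suc N) restrTerm≈W) (∑-minOdd N 1 N ℕₚ.≤-refl)

        oddMinOdd+∑P*∏≈0 : oddMinOdd 1 N + ∑ (suc N) (λ k → P (suc k)) * ∏1+q^ 1 N ≈ 0#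
        oddMinOdd+∑P*∏≈0 = begin
          oddMinOdd 1 N + S * ∏1+q^ 1 N         ≈⟨ +-cong restricted≈oddMinOdd (*-congˡ distinct≈∏) ⟨
          Tel.restricted 0 + S * Tel.distinct 0 ≈⟨ Tel.restricted+∑P*distinct≈0 P P-zero P-suc ⟩
          0#                                    ∎
          where
          S = ∑ (suc N) (λ k → P (suc k))

-- Formal power series

open import Data.Integer using (-_; _+_; _*_)
open ≡ using (_≗_; refl; sym; trans; cong; cong₂; module ≡-Reasoning)

Σ≤-cong : ∀ n {f g : ℕ → ℤ} → (∀ i → i ≤ n → f i ≡ g i) → Σ≤ n f ≡ Σ≤ n g
Σ≤-cong zero    f≡g = f≡g 0 z≤n
Σ≤-cong (suc n) f≡g = cong₂ _+_ (Σ≤-cong n (λ i i≤n → f≡g i (ℕₚ.m≤n⇒m≤1+n i≤n))) (f≡g (suc n) ℕₚ.≤-refl)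

Σ≤-head : ∀ n f → Σ≤ (suc n) f ≡ f 0 + Σ≤ n (f ∘ suc)
Σ≤-head zero    f = refl
Σ≤-head (suc n) f = trans (cong (_+ f (suc (suc n))) (Σ≤-head n f)) (ℤₚ.+-assoc (f 0) _ _)

Σ≤-reverse : ∀ n f → Σ≤ n f ≡ Σ≤ n (λ i → f (n ∸ i))
Σ≤-reverse zero    f = refl
Σ≤-reverse (suc n) f = begin
  Σ≤ n f + f (suc n)                      ≡⟨ cong (_+ f (suc n)) (Σ≤-reverse n f) ⟩
  Σ≤ n (λ i → f (n ∸ i)) + f (suc n)      ≡⟨ ℤₚ.+-comm _ (f (suc n)) ⟩
  f (suc n) + Σ≤ n (λ i → f (n ∸ i))      ≡⟨ Σ≤-head n (λ i → f (suc n ∸ i)) ⟨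
  Σ≤ (suc n) (λ i → f (suc n ∸ i))        ∎
  where open ≡-Reasoning

Σ≤-zero : ∀ n → Σ≤ n (λ _ → + 0) ≡ + 0
Σ≤-zero zero    = refl
Σ≤-zero (suc n) = trans (ℤₚ.+-identityʳ _) (Σ≤-zero n)

infixl 6 _⊕_

_⊕_ : Series → Series → Series
(f ⊕ g) n = f n + g n

zeros : Series
zeros _ = + 0

-- Splitting f into its constant term and q times the rest makes the Cauchy product recursive in the
-- exponent; the inductions for distributivity and associativity rest on this.
⊛-suc : ∀ f g n → (f ⊛ g) (suc n) ≡ f 0 * g (suc n) + ((f ∘ suc) ⊛ g) n
⊛-suc f g n = Σ≤-head n (λ i → f i * g (suc n ∸ i))

⊛-cong-≤ : ∀ {f f′ g g′ : Series} n → (∀ i → i ≤ n → f i ≡ f′ i) → (∀ i → i ≤ n → g i ≡ g′ i) → (f ⊛ g) n ≡ (f′ ⊛ g′) n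
⊛-cong-≤ n f≡ g≡ = Σ≤-cong n (λ i i≤n → cong₂ _*_ (f≡ i i≤n) (g≡ (n ∸ i) (ℕₚ.m∸n≤m n i)))

⊛-comm : ∀ f g → f ⊛ g ≗ g ⊛ f
⊛-comm f g n = trans (Σ≤-reverse n _) (Σ≤-cong n (λ i i≤n →
  trans (ℤₚ.*-comm (f (n ∸ i)) _) (cong (λ k → g k * f (n ∸ i)) (ℕₚ.m∸[m∸n]≡n i≤n))))

⊛-zeroˡ : ∀ f → zeros ⊛ f ≗ zeros
⊛-zeroˡ f n = trans (Σ≤-cong n (λ i _ → ℤₚ.*-zeroˡ (f (n ∸ i)))) (Σ≤-zero n)

⊛-identityˡ : ∀ f → one ⊛ f ≗ f
⊛-identityˡ f zero    = ℤₚ.*-identityˡ (f 0)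
⊛-identityˡ f (suc n) = begin
  (one ⊛ f) (suc n)                 ≡⟨ ⊛-suc one f n ⟩
  + 1 * f (suc n) + (zeros ⊛ f) n   ≡⟨ cong₂ _+_ (ℤₚ.*-identityˡ (f (suc n))) (⊛-zeroˡ f n) ⟩
  f (suc n) + + 0                   ≡⟨ ℤₚ.+-identityʳ _ ⟩
  f (suc n)                         ∎
  where open ≡-Reasoning

⊛-identityʳ : ∀ f → f ⊛ one ≗ f
⊛-identityʳ f n = trans (⊛-comm f one n) (⊛-identityˡ f n)

⊛-distribʳ : ∀ h f g → (f ⊕ g) ⊛ h ≗ (f ⊛ h) ⊕ (g ⊛ h)
⊛-distribʳ h f g zero    = ℤₚ.*-distribʳ-+ (h 0) (f 0) (g 0)
⊛-distribʳ h f g (suc n) = begin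
  ((f ⊕ g) ⊛ h) (suc n)
    ≡⟨ ⊛-suc (f ⊕ g) h n ⟩
  (f 0 + g 0) * h (suc n) + (((f ∘ suc) ⊕ (g ∘ suc)) ⊛ h) n
    ≡⟨ cong (_+_ ((f 0 + g 0) * h (suc n))) (⊛-distribʳ h (f ∘ suc) (g ∘ suc) n) ⟩
  (f 0 + g 0) * h (suc n) + (((f ∘ suc) ⊛ h) n + ((g ∘ suc) ⊛ h) n)
    ≡⟨ solve 5 (λ a b c d e → (a :+ b) :* c :+ (d :+ e) := a :* c :+ d :+ (b :* c :+ e)) refl (f 0) (g 0) (h (suc n)) _ _ ⟩
  f 0 * h (suc n) + ((f ∘ suc) ⊛ h) n + (g 0 * h (suc n) + ((g ∘ suc) ⊛ h) n)
    ≡⟨ cong₂ _+_ (⊛-suc f h n) (⊛-suc g h n) ⟨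
  (f ⊛ h) (suc n) + (g ⊛ h) (suc n) ∎
  where open ≡-Reasoning; open ℤSolver

⊛-scaleˡ : ∀ c f g → (λ i → c * f i) ⊛ g ≗ λ n → c * (f ⊛ g) n
⊛-scaleˡ c f g zero    = ℤₚ.*-assoc c (f 0) (g 0)
⊛-scaleˡ c f g (suc n) = begin
  ((λ i → c * f i) ⊛ g) (suc n)
    ≡⟨ ⊛-suc (λ i → c * f i) g n ⟩
  c * f 0 * g (suc n) + ((λ i → c * f (suc i)) ⊛ g) n
    ≡⟨ cong (_+_ (c * f 0 * g (suc n))) (⊛-scaleˡ c (f ∘ suc) g n) ⟩
  c * f 0 * g (suc n) + c * ((f ∘ suc) ⊛ g) n
    ≡⟨ solve 4 (λ c a b d → c :* a :* b :+ c :* d := c :* (a :* b :+ d)) refl c (f 0) (g (suc n)) _ ⟩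
  c * (f 0 * g (suc n) + ((f ∘ suc) ⊛ g) n)
    ≡⟨ cong (c *_) (⊛-suc f g n) ⟨
  c * (f ⊛ g) (suc n) ∎
  where open ≡-Reasoning; open ℤSolver

⊛-assoc : ∀ f g h → (f ⊛ g) ⊛ h ≗ f ⊛ (g ⊛ h)
⊛-assoc f g h zero    = ℤₚ.*-assoc (f 0) (g 0) (h 0)
⊛-assoc f g h (suc n) = begin
  ((f ⊛ g) ⊛ h) (suc n)
    ≡⟨ ⊛-suc (f ⊛ g) h n ⟩
  f 0 * g 0 * h (suc n) + (((f ⊛ g) ∘ suc) ⊛ h) n
    ≡⟨ cong (_+_ (f 0 * g 0 * h (suc n))) (⊛-cong-≤ {g = h} n (λ i _ → ⊛-suc f g i) (λ _ _ → refl)) ⟩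
  f 0 * g 0 * h (suc n) + (((λ i → f 0 * g (suc i)) ⊕ (f ∘ suc) ⊛ g) ⊛ h) n
    ≡⟨ cong (_+_ (f 0 * g 0 * h (suc n))) (⊛-distribʳ h (λ i → f 0 * g (suc i)) ((f ∘ suc) ⊛ g) n) ⟩
  f 0 * g 0 * h (suc n) + (((λ i → f 0 * g (suc i)) ⊛ h) n + ((f ∘ suc) ⊛ g ⊛ h) n)
    ≡⟨ cong (_+_ (f 0 * g 0 * h (suc n))) (cong₂ _+_ (⊛-scaleˡ (f 0) (g ∘ suc) h n) (⊛-assoc (f ∘ suc) g h n)) ⟩
  f 0 * g 0 * h (suc n) + (f 0 * ((g ∘ suc) ⊛ h) n + ((f ∘ suc) ⊛ (g ⊛ h)) n)
    ≡⟨ solve 5 (λ a b c d e → a :* b :* c :+ (a :* d :+ e) := a :* (b :* c :+ d) :+ e) refl (f 0) (g 0) (h (suc n)) _ _ ⟩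
  f 0 * (g 0 * h (suc n) + ((g ∘ suc) ⊛ h) n) + ((f ∘ suc) ⊛ (g ⊛ h)) n
    ≡⟨ cong (λ z → f 0 * z + ((f ∘ suc) ⊛ (g ⊛ h)) n) (⊛-suc g h n) ⟨
  f 0 * (g ⊛ h) (suc n) + ((f ∘ suc) ⊛ (g ⊛ h)) n
    ≡⟨ ⊛-suc f (g ⊛ h) n ⟨
  (f ⊛ (g ⊛ h)) (suc n) ∎
  where open ≡-Reasoning; open ℤSolver

infix 4 _≈[_]_

-- Equality in ℤ[[q]]/(q^(N+1)).
record _≈[_]_ (f : Series) (N : ℕ) (g : Series) : Set where
  constructor mod≈
  field coeff : ∀ n → n ≤ N → f n ≡ g n

open _≈[_]_

≗⇒≈ : ∀ {f g : Series} {N} → f ≗ g → f ≈[ N ] g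
≗⇒≈ f≗g = mod≈ λ n _ → f≗g n

truncated : ℕ → CommutativeSemiring _ _
truncated N = record
  { Carrier = Series
  ; _≈_ = λ f g → f ≈[ N ] g
  ; _+_ = _⊕_
  ; _*_ = _⊛_
  ; 0# = zeros
  ; 1# = one
  ; isCommutativeSemiring = record
    { isSemiring = record
      { isSemiringWithoutAnnihilatingZero = record
        { +-isCommutativeMonoid = record
          { isMonoid = record
            { isSemigroup = record
              { isMagma = record
                { isEquivalence = record
                  { refl = mod≈ λ _ _ → refl
                  ; sym = λ f≈g → mod≈ λ n n≤N → sym (coeff f≈g n n≤N)
                  ; trans = λ f≈g g≈h → mod≈ λ n n≤N → trans (coeff f≈g n n≤N) (coeff g≈h n n≤N)
                  }
                ; ∙-cong = λ f≈ g≈ → mod≈ λ n n≤N → cong₂ _+_ (coeff f≈ n n≤N) (coeff g≈ n n≤N)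
                }
              ; assoc = λ f g h → ≗⇒≈ λ n → ℤₚ.+-assoc (f n) (g n) (h n)
              }
            ; identity = (λ f → ≗⇒≈ λ n → ℤₚ.+-identityˡ (f n)) , (λ f → ≗⇒≈ λ n → ℤₚ.+-identityʳ (f n))
            }
          ; comm = λ f g → ≗⇒≈ λ n → ℤₚ.+-comm (f n) (g n)
          }
        ; *-cong = λ f≈ g≈ → mod≈ λ n n≤N → ⊛-cong-≤ n (λ i i≤n → coeff f≈ i (ℕₚ.≤-trans i≤n n≤N)) (λ i i≤n → coeff g≈ i (ℕₚ.≤-trans i≤n n≤N))
        ; *-assoc = λ f g h → ≗⇒≈ λ n → ⊛-assoc f g h n
        ; *-identity = (λ f → ≗⇒≈ (⊛-identityˡ f)) , (λ f → ≗⇒≈ (⊛-identityʳ f))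
        ; distrib = (λ f g h → ≗⇒≈ λ n → trans (⊛-comm f (g ⊕ h) n) (trans (⊛-distribʳ f g h n) (cong₂ _+_ (⊛-comm g f n) (⊛-comm h f n))))
                  , (λ h f g → ≗⇒≈ λ n → ⊛-distribʳ h f g n)
        }
      ; zero = (λ f → ≗⇒≈ λ n → ⊛-zeroˡ f n) , (λ f → ≗⇒≈ λ n → trans (⊛-comm f zeros n) (⊛-zeroˡ f n))
      }
    ; *-comm = λ f g → ≗⇒≈ λ n → ⊛-comm f g n
    }
  }

-- Monomials, 1/(1 - q^m) and 1 + q^m

q^ : ℕ → Series
q^ m = shift m one

shift-suc : ∀ m f n → shift (suc m) f (suc n) ≡ shift m f n
shift-suc zero    f n = refl
shift-suc (suc m) f n = refl

shift-q^ : ∀ m f → shift m f ≗ q^ m ⊛ f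
shift-q^ zero    f n       = sym (⊛-identityˡ f n)
shift-q^ (suc m) f zero    = sym (ℤₚ.*-zeroˡ (f 0))
shift-q^ (suc m) f (suc n) = begin
  shift (suc m) f (suc n)                       ≡⟨ shift-suc m f n ⟩
  shift m f n                                   ≡⟨ shift-q^ m f n ⟩
  (q^ m ⊛ f) n                                  ≡⟨ ⊛-cong-≤ {g = f} n (λ i _ → shift-suc m one i) (λ _ _ → refl) ⟨
  ((q^ (suc m) ∘ suc) ⊛ f) n                    ≡⟨ ℤₚ.+-identityˡ _ ⟨
  + 0 + ((q^ (suc m) ∘ suc) ⊛ f) n              ≡⟨ cong (_+ ((q^ (suc m) ∘ suc) ⊛ f) n) (ℤₚ.*-zeroˡ (f (suc n))) ⟨
  + 0 * f (suc n) + ((q^ (suc m) ∘ suc) ⊛ f) n  ≡⟨ ⊛-suc (q^ (suc m)) f n ⟨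
  (q^ (suc m) ⊛ f) (suc n)                      ∎
  where open ≡-Reasoning

shift-+ : ∀ a b f → shift (a ℕ.+ b) f ≗ shift a (shift b f)
shift-+ zero    b f n       = refl
shift-+ (suc a) b f zero    = refl
shift-+ (suc a) b f (suc n) = trans (shift-suc (a ℕ.+ b) f n) (trans (shift-+ a b f n) (sym (shift-suc a (shift b f) n)))

q^-+ : ∀ a b → q^ (a ℕ.+ b) ≗ q^ a ⊛ q^ b
q^-+ a b n = trans (shift-+ a b one n) (shift-q^ a (q^ b) n)

shift-low : ∀ {m n} f → n < m → shift m f n ≡ + 0
shift-low {suc m} {zero}  f _         = refl
shift-low {suc m} {suc n} f (s≤s n<m) = trans (shift-suc m f n) (shift-low f n<m)

q^-vanishes : ∀ {N m} → N < m → q^ m ≈[ N ] zeros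
q^-vanishes N<m = mod≈ λ n n≤N → shift-low one (ℕₚ.≤-<-trans n≤N N<m)

shift-high : ∀ m f n → shift m f (n ℕ.+ m) ≡ f n
shift-high zero    f n = cong f (ℕₚ.+-identityʳ n)
shift-high (suc m) f n rewrite ℕₚ.+-suc n m = trans (shift-suc m f (n ℕ.+ m)) (shift-high m f n)

-- Below exponent m + 1 both sides have only the constant term; from there on the recursion is the
-- periodicity of the remainder modulo m + 1.
geomInv-inverse : ∀ m → geomInv (suc m) ≗ one ⊕ (q^ (suc m) ⊛ geomInv (suc m))
geomInv-inverse m n = trans (lemma n (n ℕ.<? suc m)) (cong (_+_ (one n)) (shift-q^ (suc m) G n))
  where
  G = geomInv (suc m)
  indicator : ℕ → ℤ
  indicator r = if r ≡ᵇ 0 then + 1 else + 0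
  one-high : ∀ k → one (k ℕ.+ suc m) ≡ + 0
  one-high k = cong one (ℕₚ.+-suc k m)
  lemma : ∀ n → Dec (n < suc m) → G n ≡ one n + shift (suc m) G n
  lemma zero    (yes _)   = refl
  lemma (suc n) (yes n<m) = trans (cong indicator (DivMod.m<n⇒m%n≡m n<m))
                                  (sym (cong (_+_ (+ 0)) (shift-low G n<m)))
  lemma n       (no n≮m)  = ≡.subst (λ n → G n ≡ one n + shift (suc m) G n) (ℕₚ.m∸n+n≡m (ℕₚ.≮⇒≥ n≮m)) (begin
    G (k ℕ.+ suc m)                                          ≡⟨ cong indicator (DivMod.[m+n]%n≡m%n k (suc m)) ⟩
    G k                                                      ≡⟨ shift-high (suc m) G k ⟨
    shift (suc m) G (k ℕ.+ suc m)                            ≡⟨ ℤₚ.+-identityˡ _ ⟨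
    + 0 + shift (suc m) G (k ℕ.+ suc m)                      ≡⟨ cong (_+ shift (suc m) G (k ℕ.+ suc m)) (one-high k) ⟨
    one (k ℕ.+ suc m) + shift (suc m) G (k ℕ.+ suc m)        ∎)
    where
    open ≡-Reasoning
    k = n ∸ suc m

onePlusQ-q^ : ∀ m → onePlusQ (suc m) ≗ one ⊕ q^ (suc m)
onePlusQ-q^ m zero    = refl
onePlusQ-q^ m (suc n) = trans (lemma m n) (sym (trans (ℤₚ.+-identityˡ _) (shift-suc m one n)))
  where
  lemma : ∀ m n → (if n ≡ᵇ m then + 1 else + 0) ≡ q^ m n
  lemma zero    zero    = refl
  lemma zero    (suc n) = refl
  lemma (suc m) zero    = refl
  lemma (suc m) (suc n) = trans (lemma m n) (sym (shift-suc m one n))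

-- The substitution q ↦ -q

sgn : ℕ → ℤ
sgn zero    = + 1
sgn (suc n) = - sgn n

-- Replaces the parity test by a factor multiplicative in the exponent, from which compatibility
-- with products follows.
negQ-sgn : ∀ f n → negQ f n ≡ sgn n * f n
negQ-sgn f n = lemma n (f n)
  where
  lemma : ∀ n z → (if n % 2 ≡ᵇ 0 then z else - z) ≡ sgn n * z
  lemma zero          z = sym (ℤₚ.*-identityˡ z)
  lemma (suc zero)    z = sym (ℤₚ.-1*i≡-i z)
  lemma (suc (suc n)) z = trans (lemma n z) (cong (_* z) (sym (ℤₚ.neg-involutive (sgn n))))

sgn-+ : ∀ m n → sgn (m ℕ.+ n) ≡ sgn m * sgn n
sgn-+ zero    n = sym (ℤₚ.*-identityˡ (sgn n))
sgn-+ (suc m) n = trans (cong -_ (sgn-+ m n)) (ℤₚ.neg-distribˡ-* (sgn m) (sgn n))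

negQ-cong : ∀ {f g} → f ≗ g → negQ f ≗ negQ g
negQ-cong {f} {g} f≗g n = trans (negQ-sgn f n) (trans (cong (sgn n *_) (f≗g n)) (sym (negQ-sgn g n)))

negQ-⊕ : ∀ f g → negQ (f ⊕ g) ≗ negQ f ⊕ negQ g
negQ-⊕ f g n = trans (negQ-sgn (f ⊕ g) n) (trans (ℤₚ.*-distribˡ-+ (sgn n) (f n) (g n)) (sym (cong₂ _+_ (negQ-sgn f n) (negQ-sgn g n))))

negQ-one : negQ one ≗ one
negQ-one zero    = refl
negQ-one (suc n) = trans (negQ-sgn one (suc n)) (ℤₚ.*-zeroʳ (sgn (suc n)))

negQ-⊛ : ∀ f g → negQ (f ⊛ g) ≗ negQ f ⊛ negQ g
negQ-⊛ f g n = begin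
  negQ (f ⊛ g) n                                                ≡⟨ negQ-sgn (f ⊛ g) n ⟩
  sgn n * Σ≤ n (λ i → f i * g (n ∸ i))                          ≡⟨ Σ≤-*ˡ n (sgn n) _ ⟩
  Σ≤ n (λ i → sgn n * (f i * g (n ∸ i)))                        ≡⟨ Σ≤-cong n term ⟩
  (negQ f ⊛ negQ g) n                                           ∎
  where
  open ≡-Reasoning; open ℤSolver
  Σ≤-*ˡ : ∀ n c h → c * Σ≤ n h ≡ Σ≤ n (λ i → c * h i)
  Σ≤-*ˡ zero    c h = refl
  Σ≤-*ˡ (suc n) c h = trans (ℤₚ.*-distribˡ-+ c (Σ≤ n h) (h (suc n))) (cong (_+ c * h (suc n)) (Σ≤-*ˡ n c h))
  term : ∀ i → i ≤ n → sgn n * (f i * g (n ∸ i)) ≡ negQ f i * negQ g (n ∸ i)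
  term i i≤n = begin
    sgn n * (f i * g (n ∸ i))                    ≡⟨ cong (λ k → sgn k * (f i * g (n ∸ i))) (ℕₚ.m+[n∸m]≡n i≤n) ⟨
    sgn (i ℕ.+ (n ∸ i)) * (f i * g (n ∸ i))      ≡⟨ cong (_* (f i * g (n ∸ i))) (sgn-+ i (n ∸ i)) ⟩
    sgn i * sgn (n ∸ i) * (f i * g (n ∸ i))      ≡⟨ solve 4 (λ a b c d → a :* b :* (c :* d) := (a :* c) :* (b :* d)) refl (sgn i) (sgn (n ∸ i)) (f i) (g (n ∸ i)) ⟩
    sgn i * f i * (sgn (n ∸ i) * g (n ∸ i))      ≡⟨ cong₂ _*_ (negQ-sgn f i) (negQ-sgn g (n ∸ i)) ⟨
    negQ f i * negQ g (n ∸ i)                    ∎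

-- The source of every sign in ψ(-q), written as a vanishing sum to suit the semiring.
negQ-q^-odd : ∀ m n → negQ (q^ (suc (2 ℕ.* m))) n + q^ (suc (2 ℕ.* m)) n ≡ + 0
negQ-q^-odd m n = trans (cong (_+ q^ (suc (2 ℕ.* m)) n) (negQ-sgn (q^ (suc (2 ℕ.* m))) n)) (lemma n (n ℕ.≟ suc (2 ℕ.* m)))
  where
  sgn-double : ∀ m → sgn (2 ℕ.* m) ≡ + 1
  sgn-double zero    = refl
  sgn-double (suc m) rewrite ℕₚ.+-suc m (m ℕ.+ 0) = trans (ℤₚ.neg-involutive _) (sgn-double m)
  q^-off : ∀ k n → n ≡.≢ k → q^ k n ≡ + 0
  q^-off zero    zero    n≢k = contradiction refl n≢k
  q^-off zero    (suc n) n≢k = refl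
  q^-off (suc k) zero    n≢k = refl
  q^-off (suc k) (suc n) n≢k = trans (shift-suc k one n) (q^-off k n (n≢k ∘ cong suc))
  lemma : ∀ n → Dec (n ≡ suc (2 ℕ.* m)) → sgn n * q^ (suc (2 ℕ.* m)) n + q^ (suc (2 ℕ.* m)) n ≡ + 0
  lemma n (yes refl) rewrite sgn-double m = trans (cong (_+ Q) (ℤₚ.-1*i≡-i Q)) (ℤₚ.+-inverseˡ Q)
    where Q = q^ (suc (2 ℕ.* m)) (suc (2 ℕ.* m))
  lemma n (no n≢) rewrite q^-off (suc (2 ℕ.* m)) n n≢ = cong (_+ + 0) (ℤₚ.*-zeroʳ (sgn n))

-- Counting sublists

count : (List ℕ → Bool) → List (List ℕ) → ℕ
count p L = length (filterᵇ p L)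

count-++ : ∀ p L M → count p (L ++ M) ≡ count p L ℕ.+ count p M
count-++ p []      M = refl
count-++ p (s ∷ L) M with p s
... | true  = cong suc (count-++ p L M)
... | false = count-++ p L M

count-map : ∀ p g L → count p (map g L) ≡ count (p ∘ g) L
count-map p g []      = refl
count-map p g (s ∷ L) with p (g s)
... | true  = cong suc (count-map p g L)
... | false = count-map p g L

count-cong : ∀ {p p′ L} → All (λ s → p s ≡ p′ s) L → count p L ≡ count p′ L
count-cong               []         = refl
count-cong {p} {p′} {s ∷ L} (eq ∷ eqs) with p s | p′ s | eq
... | true  | _ | refl = cong suc (count-cong eqs)
... | false | _ | refl = count-cong eqs

count-∧ : ∀ c p L → count (λ s → c ∧ p s) L ≡ (if c then count p L else 0)
count-∧ true  p L       = refl
count-∧ false p []      = refl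
count-∧ false p (s ∷ L) = count-∧ false p L

count-sublists-∷ : ∀ p x xs → count p (sublists (x ∷ xs)) ≡ count p (sublists xs) ℕ.+ count (p ∘ (x ∷_)) (sublists xs)
count-sublists-∷ p x xs = trans (count-++ p (sublists xs) _) (cong (count p (sublists xs) ℕ.+_) (count-map p (x ∷_) (sublists xs)))

All-sublists : ∀ {P : ℕ → Set} {xs} → All P xs → All (All P) (sublists xs)
All-sublists []         = [] ∷ []
All-sublists (px ∷ pxs) = All.++⁺ (All-sublists pxs) (All.map⁺ (All.map (px ∷_) (All-sublists pxs)))

minPart-∷ : ∀ {x s} → All (x ≤_) s → minPart (x ∷ s) ≡ x
minPart-∷ []                     = refl
minPart-∷ {x} {y ∷ s} (x≤y ∷ x≤s) = trans (cong (y ⊓_) (minPart-∷ x≤s)) (ℕₚ.m≥n⇒m⊓n≡n x≤y)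

oddᵇ-suc : ∀ n → oddᵇ (suc n) ≡ not (oddᵇ n)
oddᵇ-suc zero          = refl
oddᵇ-suc (suc zero)    = refl
oddᵇ-suc (suc (suc n)) = oddᵇ-suc n

≤ᵇ-suc : ∀ m n → (suc m ≤ᵇ suc n) ≡ (m ≤ᵇ n)
≤ᵇ-suc zero    n = refl
≤ᵇ-suc (suc m) n = refl

-- The test `x ≤ᵇ n` guards the truncated subtraction and is the one made by `shift`.
+-≡ᵇ : ∀ x m n → (x ℕ.+ m ≡ᵇ n) ≡ (x ≤ᵇ n) ∧ (m ≡ᵇ n ∸ x)
+-≡ᵇ zero    m n       = refl
+-≡ᵇ (suc x) m zero    = refl
+-≡ᵇ (suc x) m (suc n) = trans (+-≡ᵇ x m n) (cong (_∧ (m ≡ᵇ n ∸ x)) (sym (≤ᵇ-suc x n)))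

hasParity : Bool → ℕ → Bool
hasParity odd n = if odd then oddᵇ n else not (oddᵇ n)

hasParity-suc : ∀ odd n → hasParity odd (suc n) ≡ hasParity (not odd) n
hasParity-suc true  n = oddᵇ-suc n
hasParity-suc false n rewrite oddᵇ-suc n with oddᵇ n
... | true  = refl
... | false = refl

sumParity : Bool → ℕ → List ℕ → Bool
sumParity odd n s = (sum s ≡ᵇ n) ∧ hasParity odd (length s)

sumOddMinOdd : ℕ → List ℕ → Bool
sumOddMinOdd n s = (sum s ≡ᵇ n) ∧ oddᵇ (length s) ∧ oddᵇ (minPart s)

sumParity-∷ : ∀ odd x n s → sumParity odd n (x ∷ s) ≡ (x ≤ᵇ n) ∧ sumParity (not odd) (n ∸ x) s
sumParity-∷ odd x n s = trans (cong₂ _∧_ (+-≡ᵇ x (sum s) n) (hasParity-suc odd (length s))) (∧-assoc (x ≤ᵇ n) _ _)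

-- As x is the least part, its parity settles the condition before s is inspected; the test is moved
-- to the front, where `q^ifOdd` branches.
sumOddMinOdd-∷ : ∀ x n s → All (x ≤_) s → sumOddMinOdd n (x ∷ s) ≡ oddᵇ x ∧ (x ≤ᵇ n) ∧ sumParity false (n ∸ x) s
sumOddMinOdd-∷ x n s x≤s = begin
  (sum (x ∷ s) ≡ᵇ n) ∧ oddᵇ (suc (length s)) ∧ oddᵇ (minPart (x ∷ s))
    ≡⟨ ∧-assoc (sum (x ∷ s) ≡ᵇ n) _ _ ⟨
  sumParity true n (x ∷ s) ∧ oddᵇ (minPart (x ∷ s))
    ≡⟨ cong₂ (λ b m → b ∧ oddᵇ m) (sumParity-∷ true x n s) (minPart-∷ x≤s) ⟩
  ((x ≤ᵇ n) ∧ sumParity false (n ∸ x) s) ∧ oddᵇ x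
    ≡⟨ ∧-comm _ (oddᵇ x) ⟩
  oddᵇ x ∧ (x ≤ᵇ n) ∧ sumParity false (n ∸ x) s ∎
  where open ≡-Reasoning

shift-count : ∀ (F : ℕ → List ℕ → Bool) L {f} → (∀ n → f n ≡ + count (F n) L) →
  ∀ a n → shift a f n ≡ + count (λ s → (a ≤ᵇ n) ∧ F (n ∸ a) s) L
shift-count F L f≡ a n rewrite count-∧ (a ≤ᵇ n) (F (n ∸ a)) L with a ≤ᵇ n
... | true  = f≡ (n ∸ a)
... | false = refl

-- The inverses of 1 + q^(2m+1) and the summands of ψ(-q)

negQ-annihilates : ∀ m f → negQ (q^ (suc (2 ℕ.* m))) ⊛ f ⊕ q^ (suc (2 ℕ.* m)) ⊛ f ≗ zeros
negQ-annihilates m f n = begin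
  (negQ x ⊛ f) n + (x ⊛ f) n  ≡⟨ ⊛-distribʳ f (negQ x) x n ⟨
  ((negQ x ⊕ x) ⊛ f) n        ≡⟨ ⊛-cong-≤ {g = f} n (λ i _ → negQ-q^-odd m i) (λ _ _ → refl) ⟩
  (zeros ⊛ f) n               ≡⟨ ⊛-zeroˡ f n ⟩
  + 0                         ∎
  where
  open ≡-Reasoning
  x = q^ (suc (2 ℕ.* m))

1/[1+q^] : ℕ → Series
1/[1+q^] m = negQ (geomInv (suc (2 ℕ.* m)))

1/[1+q^]-inverse : ∀ m → 1/[1+q^] m ⊕ q^ (suc (2 ℕ.* m)) ⊛ 1/[1+q^] m ≗ one
1/[1+q^]-inverse m n = begin
  1/[1+q^] m n + (x ⊛ 1/[1+q^] m) n                        ≡⟨ cong (_+ (x ⊛ 1/[1+q^] m) n) expand ⟩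
  one n + (negQ x ⊛ 1/[1+q^] m) n + (x ⊛ 1/[1+q^] m) n     ≡⟨ ℤₚ.+-assoc (one n) _ _ ⟩
  one n + ((negQ x ⊛ 1/[1+q^] m) n + (x ⊛ 1/[1+q^] m) n)   ≡⟨ cong (_+_ (one n)) (negQ-annihilates m (1/[1+q^] m) n) ⟩
  one n + + 0                                ≡⟨ ℤₚ.+-identityʳ (one n) ⟩
  one n                                      ∎
  where
  open ≡-Reasoning
  x = q^ (suc (2 ℕ.* m))
  G = geomInv (suc (2 ℕ.* m))
  expand : 1/[1+q^] m n ≡ one n + (negQ x ⊛ 1/[1+q^] m) n
  expand = begin
    negQ G n                        ≡⟨ negQ-cong (geomInv-inverse (2 ℕ.* m)) n ⟩
    negQ (one ⊕ x ⊛ G) n            ≡⟨ negQ-⊕ one (x ⊛ G) n ⟩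
    negQ one n + negQ (x ⊛ G) n     ≡⟨ cong₂ _+_ (negQ-one n) (negQ-⊛ x G n) ⟩
    one n + (negQ x ⊛ 1/[1+q^] m) n        ∎

-- Equal to (-1)^n q^(n^2) / (-q;q^2)_n, as n^2 and n have the same parity. The index 0, absent from
-- `ψ`, supplies the initial value 1 of the recursion.
ψTerm : ℕ → Series
ψTerm n = negQ (q^ (n ℕ.* n) ⊛ invQQ2 n)

ψTerm-zero : ψTerm 0 ≗ one
ψTerm-zero n = trans (negQ-cong (⊛-identityˡ one) n) (negQ-one n)

-- The gap 2n + 1 between consecutive squares is also the exponent in the new denominator factor, so
-- the ratio of consecutive summands is x/(1 - x) with x = q^(2n+1).
invQQ2-suc : ∀ n → q^ (suc n ℕ.* suc n) ⊛ invQQ2 (suc n)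
                   ≗ q^ (suc (2 ℕ.* n)) ⊛ (geomInv (suc (2 ℕ.* n)) ⊛ (q^ (n ℕ.* n) ⊛ invQQ2 n))
invQQ2-suc n k = begin
  (q^ (suc n ℕ.* suc n) ⊛ (invQQ2 n ⊛ geomInv (2 ℕ.* n ℕ.+ 1))) k
    ≡⟨ cong₂ (λ a b → (q^ a ⊛ (invQQ2 n ⊛ geomInv b)) k) (suc-square n) (ℕₚ.+-comm (2 ℕ.* n) 1) ⟩
  (q^ (suc (2 ℕ.* n) ℕ.+ n ℕ.* n) ⊛ (invQQ2 n ⊛ G)) k
    ≡⟨ ⊛-cong-≤ {g = invQQ2 n ⊛ G} k (λ i _ → q^-+ (suc (2 ℕ.* n)) (n ℕ.* n) i) (λ _ _ → refl) ⟩
  (q^ (suc (2 ℕ.* n)) ⊛ q^ (n ℕ.* n) ⊛ (invQQ2 n ⊛ G)) k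
    ≡⟨ coeff (solve 4 (λ x y i g → x :* y :* (i :* g) := x :* (g :* (y :* i))) (mod≈ λ _ _ → refl) (q^ (suc (2 ℕ.* n))) (q^ (n ℕ.* n)) (invQQ2 n) G) k ℕₚ.≤-refl ⟩
  (q^ (suc (2 ℕ.* n)) ⊛ (G ⊛ (q^ (n ℕ.* n) ⊛ invQQ2 n))) k ∎
  where
  open ≡-Reasoning
  open SemiringSolver (truncated k)
  G = geomInv (suc (2 ℕ.* n))

ψTerm-suc : ∀ n → ψTerm (suc n) ⊕ q^ (suc (2 ℕ.* n)) ⊛ 1/[1+q^] n ⊛ ψTerm n ≗ zeros
ψTerm-suc n k = begin
  ψTerm (suc n) k + (x ⊛ 1/[1+q^] n ⊛ ψTerm n) k
    ≡⟨ cong₂ _+_ expand (⊛-assoc x (1/[1+q^] n) (ψTerm n) k) ⟩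
  (negQ x ⊛ (1/[1+q^] n ⊛ ψTerm n)) k + (x ⊛ (1/[1+q^] n ⊛ ψTerm n)) k
    ≡⟨ negQ-annihilates n (1/[1+q^] n ⊛ ψTerm n) k ⟩
  + 0 ∎
  where
  open ≡-Reasoning
  x = q^ (suc (2 ℕ.* n))
  G = geomInv (suc (2 ℕ.* n))
  F = q^ (n ℕ.* n) ⊛ invQQ2 n
  expand : ψTerm (suc n) k ≡ (negQ x ⊛ (1/[1+q^] n ⊛ ψTerm n)) k
  expand = begin
    ψTerm (suc n) k                  ≡⟨ negQ-cong (invQQ2-suc n) k ⟩
    negQ (x ⊛ (G ⊛ F)) k         ≡⟨ negQ-⊛ x (G ⊛ F) k ⟩
    (negQ x ⊛ negQ (G ⊛ F)) k    ≡⟨ ⊛-cong-≤ {f = negQ x} k (λ _ _ → refl) (λ i _ → negQ-⊛ G F i) ⟩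
    (negQ x ⊛ (1/[1+q^] n ⊛ ψTerm n)) k     ∎

ψTerm-low : ∀ {n k} → k ≤ n → ψTerm (suc n) k ≡ + 0
ψTerm-low {n} {k} k≤n = begin
  ψTerm (suc n) k                                                 ≡⟨ negQ-sgn (q^ (suc n ℕ.* suc n) ⊛ invQQ2 (suc n)) k ⟩
  sgn k * (q^ (suc n ℕ.* suc n) ⊛ invQQ2 (suc n)) k           ≡⟨ cong (_*_ (sgn k)) (shift-q^ (suc n ℕ.* suc n) (invQQ2 (suc n)) k) ⟨
  sgn k * shift (suc n ℕ.* suc n) (invQQ2 (suc n)) k          ≡⟨ cong (_*_ (sgn k)) (shift-low (invQQ2 (suc n)) (s≤s (ℕₚ.≤-trans k≤n (ℕₚ.m≤m+n n _)))) ⟩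
  sgn k * + 0                                                 ≡⟨ ℤₚ.*-zeroʳ (sgn k) ⟩
  + 0                                                         ∎
  where open ≡-Reasoning

onePlusQ-low : ∀ {i k} → i ≤ k → onePlusQ (suc k) i ≡ one i
onePlusQ-low {i} {k} i≤k = begin
  onePlusQ (suc k) i        ≡⟨ onePlusQ-q^ k i ⟩
  one i + q^ (suc k) i      ≡⟨ cong (_+_ (one i)) (shift-low one (s≤s i≤k)) ⟩
  one i + + 0               ≡⟨ ℤₚ.+-identityʳ (one i) ⟩
  one i                     ∎
  where open ≡-Reasoning

-- A factor 1 + q^k with k > n agrees with 1 up to q^n.
prodPlus-stable : ∀ n d → prodPlus (d ℕ.+ n) n ≡ prodPlus n n
prodPlus-stable n zero    = refl
prodPlus-stable n (suc d) = begin
  (prodPlus (d ℕ.+ n) ⊛ onePlusQ (suc (d ℕ.+ n))) n  ≡⟨ ⊛-cong-≤ {f = prodPlus (d ℕ.+ n)} n (λ _ _ → refl) (λ i i≤n → onePlusQ-low (ℕₚ.≤-trans i≤n (ℕₚ.m≤n+m n d))) ⟩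
  (prodPlus (d ℕ.+ n) ⊛ one) n                       ≡⟨ ⊛-identityʳ (prodPlus (d ℕ.+ n)) n ⟩
  prodPlus (d ℕ.+ n) n                               ≡⟨ prodPlus-stable n d ⟩
  prodPlus n n                                       ∎
  where open ≡-Reasoning

minusQInf-prodPlus : ∀ {n K} → n ≤ K → minusQInf n ≡ prodPlus K n
minusQInf-prodPlus {n} {K} n≤K = trans (sym (prodPlus-stable n (K ∸ n))) (cong (λ m → prodPlus m n) (ℕₚ.m∸n+n≡m n≤K))

-- The identity modulo q^(N+1)

module _ (N : ℕ) where
  open OverSemiring (truncated N)
  open DistinctParts q^

  -- The function `f` is known only pointwise because the recursion of `applyUpTo` replaces it by
  -- `f ∘ suc`, which does not reduce to addition of `suc a`.
  byParity-count : ∀ odd a K f → (∀ i → f i ≡ a ℕ.+ i) →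
    ∀ n → byParity odd a K n ≡ + count (sumParity odd n) (sublists (applyUpTo f K))
  byParity-count true  a zero f f≡ zero    = refl
  byParity-count true  a zero f f≡ (suc n) = refl
  byParity-count false a zero f f≡ zero    = refl
  byParity-count false a zero f f≡ (suc n) = refl
  byParity-count odd a (suc K) f f≡ n = begin
    byParity odd (suc a) K n + (q^ a ⊛ byParity (not odd) (suc a) K) n
      ≡⟨ cong₂ _+_ (ih odd n) (sym (shift-q^ a (byParity (not odd) (suc a) K) n)) ⟩
    + count (sumParity odd n) L + shift a (byParity (not odd) (suc a) K) n
      ≡⟨ cong (_+_ (+ count (sumParity odd n) L)) (shift-count (sumParity (not odd)) L (ih (not odd)) a n) ⟩
    + (count (sumParity odd n) L ℕ.+ count (λ s → (a ≤ᵇ n) ∧ sumParity (not odd) (n ∸ a) s) L)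
      ≡⟨ cong (λ k → + (count (sumParity odd n) L ℕ.+ k)) (count-cong (All.universal (λ s → sym (sumParity-∷ odd a n s)) L)) ⟩
    + (count (sumParity odd n) L ℕ.+ count (sumParity odd n ∘ (a ∷_)) L)
      ≡⟨ cong (λ x → + (count (sumParity odd n) L ℕ.+ count (sumParity odd n ∘ (x ∷_)) L)) (trans (f≡ 0) (ℕₚ.+-identityʳ a)) ⟨
    + (count (sumParity odd n) L ℕ.+ count (sumParity odd n ∘ (f 0 ∷_)) L)
      ≡⟨ cong +_ (count-sublists-∷ (sumParity odd n) (f 0) (applyUpTo (f ∘ suc) K)) ⟨
    + count (sumParity odd n) (sublists (applyUpTo f (suc K))) ∎
    where
    open ≡-Reasoning
    L = sublists (applyUpTo (f ∘ suc) K)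
    ih : ∀ odd n → byParity odd (suc a) K n ≡ + count (sumParity odd n) L
    ih odd = byParity-count odd (suc a) K (f ∘ suc) (λ i → trans (f≡ (suc i)) (ℕₚ.+-suc a i))

  oddMinOdd-count : ∀ a K f → (∀ i → f i ≡ a ℕ.+ i) →
    ∀ n → oddMinOdd a K n ≡ + count (sumOddMinOdd n) (sublists (applyUpTo f K))
  oddMinOdd-count a zero f f≡ zero    = refl
  oddMinOdd-count a zero f f≡ (suc n) = refl
  oddMinOdd-count a (suc K) f f≡ n = begin
    oddMinOdd (suc a) K n + (q^ifOdd a ⊛ byParity false (suc a) K) n
      ≡⟨ cong₂ _+_ (oddMinOdd-count (suc a) K (f ∘ suc) f∘suc≡ n) (ifOdd (oddᵇ a)) ⟩
    + (count (sumOddMinOdd n) L ℕ.+ count (λ s → oddᵇ a ∧ (a ≤ᵇ n) ∧ sumParity false (n ∸ a) s) L)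
      ≡⟨ cong (λ k → + (count (sumOddMinOdd n) L ℕ.+ k)) (count-cong (All.map (λ {s} a≤s → sym (sumOddMinOdd-∷ a n s a≤s)) (All-sublists a≤))) ⟩
    + (count (sumOddMinOdd n) L ℕ.+ count (sumOddMinOdd n ∘ (a ∷_)) L)
      ≡⟨ cong (λ x → + (count (sumOddMinOdd n) L ℕ.+ count (sumOddMinOdd n ∘ (x ∷_)) L)) (trans (f≡ 0) (ℕₚ.+-identityʳ a)) ⟨
    + (count (sumOddMinOdd n) L ℕ.+ count (sumOddMinOdd n ∘ (f 0 ∷_)) L)
      ≡⟨ cong +_ (count-sublists-∷ (sumOddMinOdd n) (f 0) (applyUpTo (f ∘ suc) K)) ⟨
    + count (sumOddMinOdd n) (sublists (applyUpTo f (suc K))) ∎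
    where
    open ≡-Reasoning
    L = sublists (applyUpTo (f ∘ suc) K)
    f∘suc≡ : ∀ i → f (suc i) ≡ suc a ℕ.+ i
    f∘suc≡ i = trans (f≡ (suc i)) (ℕₚ.+-suc a i)
    -- The range is increasing, so `a` is the least element of every sublist it is put in front of.
    a≤ : All (a ≤_) (applyUpTo (f ∘ suc) K)
    a≤ = All.applyUpTo⁺₂ (f ∘ suc) K (λ i → ≡.subst (a ≤_) (sym (f≡ (suc i))) (ℕₚ.m≤m+n a (suc i)))
    ifOdd : ∀ c → ((if c then q^ a else zeros) ⊛ byParity false (suc a) K) n
                  ≡ + count (λ s → c ∧ (a ≤ᵇ n) ∧ sumParity false (n ∸ a) s) L
    ifOdd true  = trans (sym (shift-q^ a (byParity false (suc a) K) n))
                        (shift-count (sumParity false) L (byParity-count false (suc a) K (f ∘ suc) f∘suc≡) a n)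
    ifOdd false = trans (⊛-zeroˡ (byParity false (suc a) K) n) (cong +_ (sym (count-∧ false (λ s → (a ≤ᵇ n) ∧ sumParity false (n ∸ a) s) L)))

  oddMinOdd-pdo : oddMinOdd 1 N N ≡ + pdo N
  oddMinOdd-pdo = oddMinOdd-count 1 N suc (λ _ → refl) N

  open CommutativeSemiring (truncated N) using (_≈_)

  ⊕-cancelʳ : ∀ h {f g} → f ⊕ h ≈ g ⊕ h → f ≈ g
  ⊕-cancelʳ h {f} {g} eq = mod≈ λ n n≤N → ℤ+-cancelʳ (h n) (f n) (g n) (coeff eq n n≤N)

  q^-⊛ : ∀ a b → q^ a ⊛ q^ b ≈ q^ (a ℕ.+ b)
  q^-⊛ a b = ≗⇒≈ (λ n → sym (q^-+ a b n))

  identity : oddMinOdd 1 N ⊕ ∑ (suc N) (λ k → ψTerm (suc k)) ⊛ ∏1+q^ 1 N ≈ zeros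
  identity = oddMinOdd+∑P*∏≈0 (mod≈ λ _ _ → refl) q^-⊛ N q^-vanishes ⊕-cancelʳ geomInv (λ m → ≗⇒≈ (geomInv-inverse m))
    1/[1+q^] (λ m → ≗⇒≈ (1/[1+q^]-inverse m)) ψTerm (≗⇒≈ ψTerm-zero) (λ n → ≗⇒≈ (ψTerm-suc n))

  -- The coefficient of q^n in `ψ` stops at summand n, the right side at summand N + 1; the extra
  -- summands start at q^(k^2) with k > n.
  negQψ≈∑ψTerm : negQ ψ ≈ ∑ (suc N) (λ k → ψTerm (suc k))
  negQψ≈∑ψTerm = mod≈ λ n n≤N → begin
    negQ ψ n                                    ≡⟨ negQ-sgn ψ n ⟩
    sgn n * ψ n                                 ≡⟨ partial n n ⟩
    ∑ n (λ k → ψTerm (suc k)) n                     ≡⟨ extend n (suc N ∸ n) ⟨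
    ∑ (suc N ∸ n ℕ.+ n) (λ k → ψTerm (suc k)) n     ≡⟨ cong (λ K → ∑ K (λ k → ψTerm (suc k)) n) (ℕₚ.m∸n+n≡m (ℕₚ.m≤n⇒m≤1+n n≤N)) ⟩
    ∑ (suc N) (λ k → ψTerm (suc k)) n               ∎
    where
    open ≡-Reasoning
    summand : ℕ → ℕ → ℤ
    summand n k = if k ≡ᵇ 0 then + 0 else shift (k ℕ.* k) (invQQ2 k) n
    partial : ∀ n K → sgn n * Σ≤ K (summand n) ≡ ∑ K (λ k → ψTerm (suc k)) n
    partial n zero    = ℤₚ.*-zeroʳ (sgn n)
    partial n (suc K) = trans (ℤₚ.*-distribˡ-+ (sgn n) (Σ≤ K (summand n)) _)
      (cong₂ _+_ (partial n K)
        (trans (cong (_*_ (sgn n)) (shift-q^ (suc K ℕ.* suc K) (invQQ2 (suc K)) n)) (sym (negQ-sgn (q^ (suc K ℕ.* suc K) ⊛ invQQ2 (suc K)) n))))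
    extend : ∀ n d → ∑ (d ℕ.+ n) (λ k → ψTerm (suc k)) n ≡ ∑ n (λ k → ψTerm (suc k)) n
    extend n zero    = refl
    extend n (suc d) = trans (cong (_+_ (∑ (d ℕ.+ n) (λ k → ψTerm (suc k)) n)) (ψTerm-low (ℕₚ.m≤n+m n d)))
                             (trans (ℤₚ.+-identityʳ _) (extend n d))

  prodPlus-∏ : ∀ K n → n ≤ N → prodPlus K n ≡ ∏1+q^ 1 K n
  prodPlus-∏ zero    n n≤N = refl
  prodPlus-∏ (suc K) n n≤N = trans
    (⊛-cong-≤ n (λ i i≤n → prodPlus-∏ K i (ℕₚ.≤-trans i≤n n≤N)) (λ i _ → onePlusQ-q^ K i))
    (sym (coeff (∏1+q^-last 1 K) n n≤N))

  minusQInf⊛negQψ : (minusQInf ⊛ negQ ψ) N ≡ - (+ pdo N)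
  minusQInf⊛negQψ = ℤ+-cancelʳ (+ pdo N) _ _ (begin
    (minusQInf ⊛ negQ ψ) N + + pdo N        ≡⟨ ℤₚ.+-comm ((minusQInf ⊛ negQ ψ) N) (+ pdo N) ⟩
    + pdo N + (minusQInf ⊛ negQ ψ) N        ≡⟨ cong₂ _+_ (sym oddMinOdd-pdo) product ⟩
    (oddMinOdd 1 N ⊕ S ⊛ ∏1+q^ 1 N) N       ≡⟨ coeff identity N ℕₚ.≤-refl ⟩
    + 0                                     ≡⟨ ℤₚ.+-inverseˡ (+ pdo N) ⟨
    - (+ pdo N) + + pdo N                   ∎)
    where
    open ≡-Reasoning
    S = ∑ (suc N) (λ k → ψTerm (suc k))
    product : (minusQInf ⊛ negQ ψ) N ≡ (S ⊛ ∏1+q^ 1 N) N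
    product = trans (⊛-comm minusQInf (negQ ψ) N)
      (⊛-cong-≤ N (coeff negQψ≈∑ψTerm) (λ i i≤N → trans (minusQInf-prodPlus i≤N) (prodPlus-∏ N i i≤N)))

theorem1p6 : (N : ℕ) → (minusQInf ⊛ negQ ψ) N ≡ rhs N
-- At 0 the only sublist is empty and has an even number of parts, so `pdo 0` computes to 0, in
-- agreement with `rhs`.
theorem1p6 zero    = minusQInf⊛negQψ zero
theorem1p6 (suc n) = minusQInf⊛negQψ (suc n)
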